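{- Let $\langle\mathbb A,\alpha\rangle$, $\langle\mathbb B,\beta\rangle$ be countable incompressible dynamical systems, $\iota$ an embedding of $\langle\mathbb A,\alpha\rangle$ into $\langle\mathbb B,\beta\rangle$, and $\eta$ an embedding of $\langle\mathbb A,\alpha\rangle$ into $\langle\mathcal P(\omega)/\mathrm{Fin},\sigma\rangle$. If $\langle\mathbb A,\alpha\rangle$ is polarized, then there is an embedding $\bar\eta$ of $\langle\mathbb B,\beta\rangle$ into $\langle\mathcal P(\omega)/\mathrm{Fin},\sigma\rangle$ with $\bar\eta\circ\iota=\eta$.
   Context: $\mathcal P(\omega)/\mathrm{Fin}$ is $\mathcal P(\omega)$ modulo finite sets, $\sigma([A])=[A+1]$. Dynamical system: Boolean algebra with automorphism; embedding: injective Boolean homomorphism commuting with the automorphisms; incompressible: no $x\notin\{\mathbf 0,\mathbf 1\}$ with $\alpha(x)\le x$. A partition of $\mathbb A$ is a finite set of nonzero pairwise disjoint elements with join $\mathbf 1$; $\mathcal A'$ refines $\mathcal A$ if each member of $\mathcal A'$ is below a member of $\mathcal A$, and the natural map $\pi:\mathcal A'\to\mathcal A$ sends $x$ to the member of $\mathcal A$ above it. The digraph $\langle\mathcal A,\to_\alpha\rangle$ has $x\to_\alpha y$ iff $\alpha(x)\wedge y\ne\mathbf 0$. Digraphs are finite; strongly connected means any vertex reaches any vertex by a walk. An epimorphism from $\langle\mathcal V,\to_{\mathcal V}\rangle$ onto $\langle\mathcal U,\to_{\mathcal U}\rangle$ is a surjection $\phi:\mathcal V\to\mathcal U$ such that $u\to_{\mathcal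 U}u'$ iff there are $v\in\phi^{ -1}(u),v'\in\phi^{ -1}(u')$ with $v\to_{\mathcal V}v'$. A virtual refinement of $\langle\mathcal A,\to_\alpha\rangle$ is a pair $(\phi,\langle\mathcal V,\to\rangle)$ with $\langle\mathcal V,\to\rangle$ strongly connected and $\phi$ an epimorphism onto $\langle\mathcal A,\to_\alpha\rangle$; a partition $\mathcal A'$ realizes it if $\mathcal A'$ refines $\mathcal A$ and there is a digraph isomorphism $\psi:\langle\mathcal V,\to\rangle\to\langle\mathcal A',\to_\alpha\rangle$ with $\pi\circ\psi=\phi$. Two epimorphisms $\phi:\langle\mathcal U,\to_{\mathcal U}\rangle\to\langle\mathcal A,\to\rangle$, $\psi:\langle\mathcal V,\to_{\mathcal V}\rangle\to\langle\mathcal A,\to\rangle$ between strongly connected digraphs are compatible if there are a strongly connected digraph $\langle\mathcal W,\to_{\mathcal W}\rangle$ and epimorphisms $\bar\phi$ onto $\langle\mathcal U,\to_{\mathcal U}\rangle$ and $\bar\psi$ onto $\langle\mathcal V,\to_{\mathcal V}\rangle$ with $\phi\circ\bar\phi=\psi\circ\bar\psi$; otherwise incompatible. A virtual refinement $(\phi,\langle\mathcal V,\to\rangle)$ of $\langle\mathcal A,\to_\alpha\rangle$ is polarized if either some partition of $\mathbb A$ realizes it, or there is a partition $\mathcal A'$ of $\mathbb A$ refining $\mathcal A$ such that $\phi$ and the natural map $\pi:\langle\mathcal A',\to_\alpha\rangle\to\langle\mathcal A,\to_\alpha\rangle$ are incompatible. $\langle\mathbb A,\alpha\rangle$ is polarized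 if every virtual refinement of $\langle\mathcal A,\to_\alpha\rangle$, for every partition $\mathcal A$ of $\mathbb A$, is polarized. -}

module Defs where

open import Level using (0ℓ)
open import Data.Bool using (Bool; true; false; not) renaming (_∧_ to _∧ᵇ_; _∨_ to _∨ᵇ_)
import Data.Bool.Properties as BP
open import Data.Nat using (ℕ; zero; suc; _≤_; _⊔_; s≤s; z≤n)
open import Data.Nat.Properties using (≤-trans; m≤m⊔n; m≤n⊔m; n≤1+n)
open import Data.Fin using (Fin) renaming (zero to fzero; suc to fsuc)
open import Data.Product using (Σ; ∃; ∃-syntax; _×_; _,_; proj₁; proj₂)
open import Data.Sum using (_⊎_)
open import Data.Empty using () renaming (⊥ to Empty)
open import Relation.Nullary using () renaming (¬_ to Not)
open import Relation.Binary.PropositionalEquality using (_≡_; _≢_; refl; sym; trans; cong₂; cong)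
open import Relation.Binary.Construct.Closure.ReflexiveTransitive using (Star)
open import Algebra.Lattice.Bundles using (BooleanAlgebra)

Subset : Set
Subset = ℕ → Bool

_=*_ : Subset → Subset → Set
A =* B = ∃[ N ] (∀ n → N ≤ n → A n ≡ B n)

private
  pw : ∀ {A B : Subset} → (∀ n → A n ≡ B n) → A =* B
  pw p = 0 , λ n _ → p n

  c₂ : ∀ (f : Bool → Bool → Bool) {A A' B B' : Subset} → A =* A' → B =* B' →
       (λ n → f (A n) (B n)) =* (λ n → f (A' n) (B' n))
  c₂ f (N , p) (M , q) =
    N ⊔ M , λ n le → cong₂ f (p n (≤-trans (m≤m⊔n N M) le)) (q n (≤-trans (m≤n⊔m N M) le))

Pω/Fin : BooleanAlgebra 0ℓ 0ℓ
Pω/Fin = record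
  { Carrier = Subset
  ; _≈_ = _=*_
  ; _∨_ = λ A B n → A n ∨ᵇ B n
  ; _∧_ = λ A B n → A n ∧ᵇ B n
  ; ¬_ = λ A n → not (A n)
  ; ⊤ = λ _ → true
  ; ⊥ = λ _ → false
  ; isBooleanAlgebra = record
    { isDistributiveLattice = record
      { isLattice = record
        { isEquivalence = record
          { refl = pw (λ _ → refl)
          ; sym = λ { (N , p) → N , λ n le → sym (p n le) }
          ; trans = λ { (N , p) (M , q) → N ⊔ M , λ n le →
              trans (p n (≤-trans (m≤m⊔n N M) le)) (q n (≤-trans (m≤n⊔m N M) le)) }
          }
        ; ∨-comm = λ A B → pw (λ n → BP.∨-comm (A n) (B n))
        ; ∨-assoc = λ A B C → pw (λ n → BP.∨-assoc (A n) (B n) (C n))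
        ; ∨-cong = c₂ _∨ᵇ_
        ; ∧-comm = λ A B → pw (λ n → BP.∧-comm (A n) (B n))
        ; ∧-assoc = λ A B C → pw (λ n → BP.∧-assoc (A n) (B n) (C n))
        ; ∧-cong = c₂ _∧ᵇ_
        ; absorptive = (λ A B → pw (λ n → BP.∨-abs-∧ (A n) (B n)))
                     , (λ A B → pw (λ n → BP.∧-abs-∨ (A n) (B n)))
        }
      ; ∨-distrib-∧ = (λ A B C → pw (λ n → BP.∨-distribˡ-∧ (A n) (B n) (C n)))
                    , (λ A B C → pw (λ n → BP.∨-distribʳ-∧ (A n) (B n) (C n)))
      ; ∧-distrib-∨ = (λ A B C → pw (λ n → BP.∧-distribˡ-∨ (A n) (B n) (C n)))
                    , (λ A B C → pw (λ n → BP.∧-distribʳ-∨ (A n) (B n) (C n)))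
      }
    ; ∨-complement = (λ A → pw (λ n → BP.∨-inverseˡ (A n)))
                   , (λ A → pw (λ n → BP.∨-inverseʳ (A n)))
    ; ∧-complement = (λ A → pw (λ n → BP.∧-inverseˡ (A n)))
                   , (λ A → pw (λ n → BP.∧-inverseʳ (A n)))
    ; ¬-cong = λ { (N , p) → N , λ n le → cong not (p n le) }
    }
  }

module _ (𝔸 𝔹 : BooleanAlgebra 0ℓ 0ℓ) where
  private
    module A = BooleanAlgebra 𝔸
    module B = BooleanAlgebra 𝔹

  record IsBoolHom (f : A.Carrier → B.Carrier) : Set where
    field
      ≈-cong : ∀ {x y} → x A.≈ y → f x B.≈ f y
      ∨-hom : ∀ x y → f (x A.∨ y) B.≈ (f x B.∨ f y)
      ∧-hom : ∀ x y → f (x A.∧ y) B.≈ (f x B.∧ f y)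
      ¬-hom : ∀ x → f (A.¬ x) B.≈ B.¬ (f x)
      ⊤-hom : f A.⊤ B.≈ B.⊤
      ⊥-hom : f A.⊥ B.≈ B.⊥

record DynSys : Set₁ where
  field
    alg    : BooleanAlgebra 0ℓ 0ℓ
  open BooleanAlgebra alg public
  field
    aut       : Carrier → Carrier
    aut-hom   : IsBoolHom alg alg aut
    aut-inj   : ∀ {x y} → aut x ≈ aut y → x ≈ y
    aut-surj  : ∀ y → ∃[ x ] (aut x ≈ y)

  _≤ᴮ_ : Carrier → Carrier → Set
  x ≤ᴮ y = (x ∧ y) ≈ x

shift : Subset → Subset
shift A zero    = false
shift A (suc n) = A n

private
  ≤-pred : ∀ {m n} → suc m ≤ suc n → m ≤ n
  ≤-pred (s≤s le) = le

shift-hom : IsBoolHom Pω/Fin Pω/Fin shift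
shift-hom = record
  { ≈-cong = λ { (N , p) → suc N , λ { zero () ; (suc n) le → p n (≤-pred le) } }
  ; ∨-hom = λ _ _ → (1 , λ { zero () ; (suc n) _ → refl })
  ; ∧-hom = λ _ _ → (1 , λ { zero () ; (suc n) _ → refl })
  ; ¬-hom = λ _ → (1 , λ { zero () ; (suc n) _ → refl })
  ; ⊤-hom = (1 , λ { zero () ; (suc n) _ → refl })
  ; ⊥-hom = 0 , λ { zero _ → refl ; (suc n) _ → refl }
  }

PωFinσ : DynSys
PωFinσ = record
  { alg = Pω/Fin
  ; aut = shift
  ; aut-hom = shift-hom
  ; aut-inj = λ { (N , p) → N , λ n le → p (suc n) (≤-trans le (n≤1+n n)) }
  ; aut-surj = λ y → (λ n → y (suc n)) , (1 , λ { zero () ; (suc n) _ → refl })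
  }

record Embedding (𝔸 𝔹 : DynSys) : Set where
  private
    module A = DynSys 𝔸
    module B = DynSys 𝔹
  field
    map     : A.Carrier → B.Carrier
    hom     : IsBoolHom A.alg B.alg map
    inj     : ∀ {x y} → map x B.≈ map y → x A.≈ y
    commute : ∀ x → map (A.aut x) B.≈ B.aut (map x)

Countable : DynSys → Set
Countable 𝔸 = Σ (ℕ → DynSys.Carrier 𝔸) λ e → ∀ (x : DynSys.Carrier 𝔸) → Σ ℕ λ n → DynSys._≈_ 𝔸 (e n) x

Incompressible : DynSys → Set
Incompressible 𝔸 = ∀ x → aut x ≤ᴮ x → Not (x ≈ ⊥) → Not (x ≈ ⊤) → Empty
  where open DynSys 𝔸

Digraph : ℕ → Set₁
Digraph n = Fin n → Fin n → Set

StronglyConnected : ∀ {n} → Digraph n → Set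
StronglyConnected {n} E = ∀ (u v : Fin n) → Star E u v

Surjective : ∀ {m n} → (Fin m → Fin n) → Set
Surjective {m} {n} f = ∀ (y : Fin n) → ∃[ x ] (f x ≡ y)

IsEpi : ∀ {m n} → Digraph m → Digraph n → (Fin m → Fin n) → Set
IsEpi {m} {n} E F φ =
  Surjective φ ×
  (∀ (u u' : Fin n) →
     (F u u' → ∃[ v ] ∃[ v' ] (φ v ≡ u × φ v' ≡ u' × E v v')) ×
     (∃[ v ] ∃[ v' ] (φ v ≡ u × φ v' ≡ u' × E v v') → F u u'))

IsIso : ∀ {m n} → Digraph m → Digraph n → (Fin m → Fin n) → Set
IsIso {m} {n} E F ψ =
  (∀ {x y} → ψ x ≡ ψ y → x ≡ y) × Surjective ψ ×
  (∀ (v v' : Fin m) → (E v v' → F (ψ v) (ψ v')) × (F (ψ v) (ψ v') → E v v'))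

Compatible : ∀ {k l n} (U : Digraph k) (V : Digraph l) (A : Digraph n) →
             (Fin k → Fin n) → (Fin l → Fin n) → Set₁
Compatible {k} {l} {n} U V A φ ψ =
  ∃[ w ] Σ (Digraph w) λ W → StronglyConnected W ×
    Σ (Fin w → Fin k) λ φ̄ → Σ (Fin w → Fin l) λ ψ̄ →
      IsEpi W U φ̄ × IsEpi W V ψ̄ × (∀ x → φ (φ̄ x) ≡ ψ (ψ̄ x))

module _ (𝔸 : DynSys) where
  open DynSys 𝔸

  bigJoin : ∀ {n} → (Fin n → Carrier) → Carrier
  bigJoin {zero}  _ = ⊥
  bigJoin {suc n} x = x fzero ∨ bigJoin (λ i → x (fsuc i))

  IsPartition : ∀ {n} → (Fin n → Carrier) → Set
  IsPartition {n} x =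
    (∀ i → Not (x i ≈ ⊥)) ×
    (∀ i j → i ≢ j → (x i ∧ x j) ≈ ⊥) ×
    (bigJoin x ≈ ⊤)

  PartDigraph : ∀ {n} → (Fin n → Carrier) → Digraph n
  PartDigraph x i j = Not ((aut (x i) ∧ x j) ≈ ⊥)

  IsNaturalMap : ∀ {m n} → (Fin m → Carrier) → (Fin n → Carrier) → (Fin m → Fin n) → Set
  IsNaturalMap A' A π = ∀ i → A' i ≤ᴮ A (π i)

  IsVirtualRefinement : ∀ {n k} → (Fin n → Carrier) → Digraph k → (Fin k → Fin n) → Set
  IsVirtualRefinement A E φ = StronglyConnected E × IsEpi E (PartDigraph A) φ

  Realizes : ∀ {n m k} → (Fin n → Carrier) → Digraph k → (Fin k → Fin n) →
             (Fin m → Carrier) → Set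
  Realizes {n} {m} {k} A E φ A' =
    IsPartition A' × Σ (Fin m → Fin n) λ π → IsNaturalMap A' A π ×
      Σ (Fin k → Fin m) λ ψ → IsIso E (PartDigraph A') ψ × (∀ v → π (ψ v) ≡ φ v)

  IsPolarizedVR : ∀ {n k} → (Fin n → Carrier) → Digraph k → (Fin k → Fin n) → Set₁
  IsPolarizedVR {n} {k} A E φ =
    (∃[ m ] Σ (Fin m → Carrier) λ A' → Realizes A E φ A')
    ⊎
    (∃[ m ] Σ (Fin m → Carrier) λ A' → IsPartition A' ×
       Σ (Fin m → Fin n) λ π → IsNaturalMap A' A π ×
         Not (Compatible E (PartDigraph A') (PartDigraph A) φ π))

Polarized : DynSys → Set₁
Polarized 𝔸 =
  ∀ n (A : Fin n → DynSys.Carrier 𝔸) → IsPartition 𝔸 A →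
  ∀ k (E : Digraph k) (φ : Fin k → Fin n) → IsVirtualRefinement 𝔸 A E φ →
  IsPolarizedVR 𝔸 A E φ

{-# OPTIONS --safe #-}
module Submission where

-- Polarization quantifies over digraphs with arbitrary edge sets, so it already implies excluded middle.
-- Classically, let X be the space of ultrafilters of 𝔹 and T its shift. An extension of η is read off a
-- sequence of points P k of X such that, for each x in 𝔹, eventually P (k + 1) (β x) = P k x; such that
-- P k (ι x) = η x k eventually for x in 𝔸; and such that each nonzero x contains P k infinitely often.
-- Since a common refinement in 𝔹 makes the incompatible alternative impossible, polarization says that a
-- finite tuple e of 𝔹 is imitated over any finite tuple of 𝔸 by a tuple w of 𝔸 with the same digraph.
-- Thus at stage n the traces under η of a tuple w n imitating e 0 , … , e (n - 1) can be used as
-- prescription for P k. Passing from stage n to n + 1 without breaking the walk requires a time at which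
-- the prescriptions agree; it exists because w n can be chosen to coincide with e at some point of X.

open import Defs
open import Level using (0ℓ)
open import Axiom.DoubleNegationElimination using (dne⇒em; em⇒dne)
open import Axiom.ExcludedMiddle using (ExcludedMiddle)
import Algebra.Lattice.Properties.BooleanAlgebra as BooleanAlgebraProperties
import Algebra.Lattice.Properties.Lattice as LatticeProperties
open import Data.Bool using (Bool; true; false; not; if_then_else_) renaming (_∧_ to _∧ᵇ_; _∨_ to _∨ᵇ_)
import Data.Bool.Properties as Boolₚ
open import Data.Empty using (⊥-elim) renaming (⊥ to Empty)
open import Data.Fin as Fin using (Fin; combine; remQuot)
import Data.Fin.Properties as Finₚ
open import Data.List using (List; []; _∷_; _++_; applyUpTo; tabulate)
open import Data.List.Membership.Propositional using (_∈_)
open import Data.List.Membership.Propositional.Properties using (∈-applyUpTo⁺; ∈-++⁺ˡ; ∈-++⁺ʳ; ∈-tabulate⁺)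
open import Data.List.Relation.Unary.Any using (here; there)
open import Data.Nat as ℕ using (ℕ; zero; suc)
import Data.Nat.Properties as ℕₚ
open import Data.Product using (Σ; ∃-syntax; _×_; _,_; proj₁; proj₂; uncurry)
open import Data.Sum using (_⊎_; inj₁; inj₂; [_,_]′)
open import Data.Unit using (tt) renaming (⊤ to Unit)
open import Relation.Binary.Construct.Closure.ReflexiveTransitive using (Star; ε; _◅_; _◅◅_; gmap)
import Relation.Binary.Lattice as OrderTheoretic
open import Relation.Binary.PropositionalEquality as ≡ using (_≡_; subst; subst₂; cong; cong₂)
import Relation.Binary.Reasoning.Setoid as SetoidReasoning
open import Relation.Nullary using (Dec; yes; no; does; contradiction; ¬¬-excluded-middle) renaming (¬_ to Not)
open import Relation.Nullary.Decidable using (dec-true)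

-- The Boolean order, finite joins and digraphs of partitions.

module Order (𝕊 : DynSys) where
  open DynSys 𝕊 public
  open BooleanAlgebraProperties alg public
    using (∧-identityʳ; ∧-zeroˡ; ∨-identityʳ; ¬-involutive)
  open LatticeProperties lattice using (∨-∧-orderTheoreticLattice)
  open OrderTheoretic.Lattice ∨-∧-orderTheoreticLattice public
    using (_≤_; x∧y≤x; x∧y≤y; ∧-greatest; x≤x∨y; y≤x∨y; ∨-least; antisym)
    renaming (refl to ≤-refl; trans to ≤-trans; reflexive to ≤-reflexive)
  open IsBoolHom aut-hom public using ()
    renaming (≈-cong to aut-cong; ∨-hom to aut-∨; ⊥-hom to aut-⊥; ⊤-hom to aut-⊤)

  x≤⊤ : ∀ {x} → x ≤ ⊤
  x≤⊤ = sym (∧-identityʳ _)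

  ⊥≤x : ∀ {x} → ⊥ ≤ x
  ⊥≤x = sym (∧-zeroˡ _)

  x≤⊥⇒x≈⊥ : ∀ {x} → x ≤ ⊥ → x ≈ ⊥
  x≤⊥⇒x≈⊥ x≤⊥ = antisym x≤⊥ ⊥≤x

  x∧¬y≈⊥⇒x≤y : ∀ {x y} → x ∧ ¬ y ≈ ⊥ → x ≤ y
  x∧¬y≈⊥⇒x≤y {x} {y} x∧¬y≈⊥ = begin
    x                    ≈⟨ ∧-identityʳ x ⟨
    x ∧ ⊤                ≈⟨ ∧-congˡ (∨-complementʳ y) ⟨
    x ∧ (y ∨ ¬ y)        ≈⟨ ∧-distribˡ-∨ x y (¬ y) ⟩
    (x ∧ y) ∨ (x ∧ ¬ y)  ≈⟨ ∨-congˡ x∧¬y≈⊥ ⟩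
    (x ∧ y) ∨ ⊥          ≈⟨ ∨-identityʳ _ ⟩
    x ∧ y                ∎
    where open SetoidReasoning setoid

  aut≈⊥⇒≈⊥ : ∀ {x} → aut x ≈ ⊥ → x ≈ ⊥
  aut≈⊥⇒≈⊥ p = aut-inj (trans p (sym aut-⊥))

  join : ∀ {n} → (Fin n → Carrier) → Carrier
  join = bigJoin 𝕊

  join-upper : ∀ {n} (f : Fin n → Carrier) i → f i ≤ join f
  join-upper f Fin.zero    = x≤x∨y _ _
  join-upper f (Fin.suc i) = ≤-trans (join-upper (λ j → f (Fin.suc j)) i) (y≤x∨y _ _)

  join-least : ∀ {n} (f : Fin n → Carrier) {z} → (∀ i → f i ≤ z) → join f ≤ z
  join-least {zero}  f le = ⊥≤x
  join-least {suc n} f le = ∨-least (le Fin.zero) (join-least (λ j → f (Fin.suc j)) (λ j → le (Fin.suc j)))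

  ∧-join-least : ∀ {n} (f : Fin n → Carrier) {x z} → (∀ i → x ∧ f i ≤ z) → x ∧ join f ≤ z
  ∧-join-least {zero}  f le = ≤-trans (x∧y≤y _ _) ⊥≤x
  ∧-join-least {suc n} f le = ≤-trans (≤-reflexive (∧-distribˡ-∨ _ _ _))
    (∨-least (le Fin.zero) (∧-join-least (λ j → f (Fin.suc j)) (λ j → le (Fin.suc j))))

  aut-join-least : ∀ {n} (f : Fin n → Carrier) {z} → (∀ i → aut (f i) ≤ z) → aut (join f) ≤ z
  aut-join-least {zero}  f le = ≤-trans (≤-reflexive aut-⊥) ⊥≤x
  aut-join-least {suc n} f le = ≤-trans (≤-reflexive (aut-∨ _ _))
    (∨-least (le Fin.zero) (aut-join-least (λ j → f (Fin.suc j)) (λ j → le (Fin.suc j))))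

-- Decidability of the edges is a parameter because these facts are used before excluded middle is
-- derived.
module PartitionDigraph (𝕊 : DynSys) {n} {x : Fin n → DynSys.Carrier 𝕊} (part : IsPartition 𝕊 x)
  (edge? : ∀ i j → Dec (DynSys._≈_ 𝕊 (DynSys._∧_ 𝕊 (DynSys.aut 𝕊 (x i)) (x j)) (DynSys.⊥ 𝕊))) where
  open Order 𝕊

  private
    nonzero  = proj₁ part
    disjoint = proj₁ (proj₂ part)
    covers   = proj₂ (proj₂ part)
    E : Digraph n
    E = PartDigraph 𝕊 x

  ≤-if-pieces : ∀ {z t} → (∀ i → z ∧ x i ≤ t) → z ≤ t
  ≤-if-pieces {z} {t} le = ≤-trans (∧-greatest ≤-refl (≤-trans x≤⊤ (≤-reflexive (sym covers)))) (∧-join-least x le)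

  successor : ∀ i → ∃[ j ] E i j
  successor i = Finₚ.¬∀⟶∃¬ _ _ (edge? i) λ all →
    nonzero i (aut≈⊥⇒≈⊥ (x≤⊥⇒x≈⊥ (≤-if-pieces λ j → ≤-reflexive (all j))))

  -- The join of the members reachable from i is mapped below itself, so incompressibility makes it ⊤.
  stronglyConnected : Incompressible 𝕊 → (∀ i j → Dec (Star E i j)) → StronglyConnected E
  stronglyConnected inc reach? i j with reach? i j
  ... | yes w = w
  ... | no ¬w = ⊥-elim (inc y (sym (aut-join-least sel sel↑))
                        (λ y≈⊥ → nonzero i (x≤⊥⇒x≈⊥ (≤-trans (x≤y ε) (≤-reflexive y≈⊥))))
                        (λ y≈⊤ → nonzero j (x≤⊥⇒x≈⊥ (≤-trans (∧-greatest ≤-refl (≤-trans x≤⊤ (≤-reflexive (sym y≈⊤))))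
                                                   (∧-join-least sel x∧sel≤⊥)))))
    where
    sel : Fin n → Carrier
    sel k with reach? i k
    ... | yes _ = x k
    ... | no  _ = ⊥
    y = join sel
    x≤y : ∀ {k} → Star E i k → x k ≤ y
    x≤y {k} w = ≤-trans x≤sel (join-upper sel k)
      where
      x≤sel : x k ≤ sel k
      x≤sel with reach? i k
      ... | yes _ = ≤-refl
      ... | no ¬w = contradiction w ¬w
    sel↑ : ∀ k → aut (sel k) ≤ y
    sel↑ k with reach? i k
    ... | no  _ = ≤-trans (≤-reflexive aut-⊥) ⊥≤x
    ... | yes w = ≤-if-pieces piece
      where
      piece : ∀ l → aut (x k) ∧ x l ≤ y
      piece l with edge? k l
      ... | yes p = ≤-trans (≤-reflexive p) ⊥≤x
      ... | no ¬p = ≤-trans (x∧y≤y _ _) (x≤y (w ◅◅ ¬p ◅ ε))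
    x∧sel≤⊥ : ∀ k → x j ∧ sel k ≤ ⊥
    x∧sel≤⊥ k with reach? i k
    ... | no  _ = x∧y≤y _ _
    ... | yes w = ≤-reflexive (disjoint j k λ { ≡.refl → ¬w w })

-- Excluded middle from polarization.

¬¬-∀ : ∀ {n} {P : Fin n → Set} → (∀ i → Not (Not (P i))) → Not (Not (∀ i → P i))
¬¬-∀ {zero}  p k = k λ ()
¬¬-∀ {suc n} p k = p Fin.zero λ p₀ → ¬¬-∀ (λ i → p (Fin.suc i)) λ ps →
  k λ { Fin.zero → p₀ ; (Fin.suc i) → ps i }

-- Double negation commutes with finite products, so inside a refutation a relation on finite sets
-- may be taken to be decidable.
¬¬-decidable : ∀ {m n} (P : Fin m → Fin n → Set) → Not (Not (∀ i j → Dec (P i j)))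
¬¬-decidable P = ¬¬-∀ λ i → ¬¬-∀ λ j → ¬¬-excluded-middle

module _ (P : Set) where

  -- Only the loop at the first vertex depends on `P`; the other edges already ensure strong
  -- connectedness and an epimorphism onto a single looped vertex.
  Loop : Digraph 2
  Loop Fin.zero    Fin.zero    = P
  Loop Fin.zero    (Fin.suc _) = Unit
  Loop (Fin.suc _) _           = Unit

  private
    pattern ₀ = Fin.zero
    pattern ₁ = Fin.suc Fin.zero

  Loop-to-₁ : ∀ a → Loop a ₁
  Loop-to-₁ ₀ = tt
  Loop-to-₁ ₁ = tt

  Loop-connected : StronglyConnected Loop
  Loop-connected a ₁ = Loop-to-₁ a ◅ ε
  Loop-connected ₀ ₀ = ε
  Loop-connected ₁ ₀ = tt ◅ ε

  module _ {n} (V : Digraph n) (connected : StronglyConnected V) (v₀ : Fin n) (next : ∀ v → ∃[ v' ] V v v') where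
    private
      Pairs : Fin 2 × Fin n → Fin 2 × Fin n → Set
      Pairs (a , v) (b , w) = Loop a b × V v w

      W : Digraph (2 ℕ.* n)
      W s t = Pairs (remQuot n s) (remQuot n t)

      -- The first coordinate waits at `₁`, whose loop is unconditional, and turns to `b` on the
      -- last step only; hence at least one edge is required.
      last : ∀ {v v₁ v'} b → V v v₁ → Star V v₁ v' → Star Pairs (₁ , v) (b , v')
      last b e ε        = (tt , e) ◅ ε
      last b e (e' ◅ w) = (tt , e) ◅ last b e' w

      Pairs-connected : ∀ s t → Star Pairs s t
      Pairs-connected (a , v) (b , v') =
        let v₁ , e₁ = next v
            v₂ , e₂ = next v₁
        in (Loop-to-₁ a , e₁) ◅ last b e₂ (connected v₂ v')

      edge : ∀ s t → Pairs s t → W (uncurry combine s) (uncurry combine t)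
      edge (a , v) (b , w) = subst₂ Pairs (≡.sym (Finₚ.remQuot-combine a v)) (≡.sym (Finₚ.remQuot-combine b w))

      W-connected : StronglyConnected W
      W-connected s t = subst₂ (Star W) (Finₚ.combine-remQuot {2} n s) (Finₚ.combine-remQuot {2} n t)
        (gmap (uncurry combine) (λ {p} {q} → edge p q) (Pairs-connected (remQuot n s) (remQuot n t)))

      left : Fin (2 ℕ.* n) → Fin 2
      left s = proj₁ (remQuot n s)

      right : Fin (2 ℕ.* n) → Fin n
      right s = proj₂ (remQuot {2} n s)

      left-combine : ∀ (a : Fin 2) (v : Fin n) → left (combine a v) ≡ a
      left-combine a v = cong proj₁ (Finₚ.remQuot-combine a v)

      right-combine : ∀ (a : Fin 2) (v : Fin n) → right (combine a v) ≡ v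
      right-combine a v = cong proj₂ (Finₚ.remQuot-combine a v)

    -- The product digraph is an amalgam: an edge of `Loop` lifts over a fixed edge leaving `v₀`, an
    -- edge of `V` over the loop at `₁`. Over a single vertex the composites agree trivially.
    Loop-compatible : ∀ {F : Digraph 1} {φ} {ψ : Fin n → Fin 1} → Compatible Loop V F φ ψ
    Loop-compatible {φ = φ} {ψ} =
      2 ℕ.* n , W , W-connected , left , right
      , ( (λ a → combine a v₀ , left-combine a v₀)
        , λ a b →
            (λ e → let v₁ , e₁ = next v₀ in
               combine a v₀ , combine b v₁ , left-combine a v₀ , left-combine b v₁ , edge (a , v₀) (b , v₁) (e , e₁))
          , λ { (s , t , p , q , e , _) → subst₂ Loop p q e })
      , ( (λ v → combine {2} ₀ v , right-combine ₀ v)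
        , λ v w →
            (λ e → combine {2} ₁ v , combine {2} ₁ w , right-combine ₁ v , right-combine ₁ w , edge (₁ , v)
                (₁ , w) (tt , e))
          , λ { (s , t , p , q , _ , e) → subst₂ V p q e })
      , λ s → unique (φ (left s)) (ψ (right s))
      where
      unique : (a b : Fin 1) → a ≡ b
      unique ₀ ₀ = ≡.refl

-- Polarization applied to the virtual refinement Loop P of the trivial partition makes P stable: the
-- incompatible alternative is impossible, and a realization identifies P with a negated statement.
polarized⇒em : (𝔸 : DynSys) → Not (DynSys._≈_ 𝔸 (DynSys.⊤ 𝔸) (DynSys.⊥ 𝔸)) →
               Incompressible 𝔸 → Polarized 𝔸 → ExcludedMiddle 0ℓ
polarized⇒em 𝔸 ⊤≉⊥ inc pol = dne⇒em λ {P} → stable P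
  where
  open Order 𝔸
  whole : Fin 1 → Carrier
  whole _ = ⊤
  whole-partition : IsPartition 𝔸 whole
  whole-partition = (λ _ → ⊤≉⊥)
    , (λ { Fin.zero Fin.zero i≢i → contradiction ≡.refl i≢i })
    , ∨-identityʳ ⊤
  whole-loop : PartDigraph 𝔸 whole Fin.zero Fin.zero
  whole-loop p = ⊤≉⊥ (trans (sym aut-⊤) (trans (sym (∧-identityʳ _)) p))
  stable : (P : Set) → Not (Not P) → P
  stable P ¬¬P with pol 1 whole whole-partition 2 (Loop P) (λ _ → Fin.zero)
    ( Loop-connected P , (λ { Fin.zero → Fin.zero , ≡.refl })
    , λ { Fin.zero Fin.zero → (λ _ → Fin.suc Fin.zero , Fin.suc Fin.zero , ≡.refl , ≡.refl , tt) , λ _ → whole-loop })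
  ... | inj₁ (m , A' , A'-part , π , nat , ψ , (_ , _ , iso) , _) =
    proj₂ (iso Fin.zero Fin.zero) λ eq → ¬¬P λ p → proj₁ (iso Fin.zero Fin.zero) p eq
  ... | inj₂ (zero , A' , (_ , _ , ⊥≈⊤) , _) = contradiction (sym ⊥≈⊤) ⊤≉⊥
  ... | inj₂ (suc m , A' , A'-part , π , nat , incompatible) = ⊥-elim
    (¬¬-decidable _ λ edge? → ¬¬-decidable _ λ reach? →
      let open PartitionDigraph 𝔸 A'-part edge? in
      incompatible (Loop-compatible P _ (stronglyConnected inc reach?) Fin.zero successor {PartDigraph 𝔸 whole}
          {ψ = π}))

-- Ultrafilters as points, and the shift on them.

true-ext : ∀ {a b} → (a ≡ true → b ≡ true) → (b ≡ true → a ≡ true) → a ≡ b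
true-ext {false} {false} f g = ≡.refl
true-ext {false} {true}  f g = g ≡.refl
true-ext {true}  {b}     f g = ≡.sym (f ≡.refl)

true≢false : ∀ {a} → a ≡ true → a ≡ false → Empty
true≢false ≡.refl ()

∧-true : ∀ {a b} → a ∧ᵇ b ≡ true → a ≡ true × b ≡ true
∧-true {true} {true} _ = ≡.refl , ≡.refl

record Point (𝕊 : DynSys) : Set where
  no-eta-equality
  open DynSys 𝕊 using (Carrier; alg)
  field
    at     : Carrier → Bool
    at-hom : IsBoolHom alg Boolₚ.∨-∧-booleanAlgebra at
  open IsBoolHom at-hom public
open Point using (at)

module _ {𝕊 : DynSys} where
  open Order 𝕊

  private
    compose : {𝕋 : DynSys} (f : DynSys.Carrier 𝕋 → Carrier) → IsBoolHom (DynSys.alg 𝕋) alg f → Point 𝕊 → Point 𝕋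
    compose f hom p = record
      { at = λ x → at p (f x)
      ; at-hom = record
        { ≈-cong = λ e → P.≈-cong (H.≈-cong e)
        ; ∨-hom = λ x y → ≡.trans (P.≈-cong (H.∨-hom x y)) (P.∨-hom _ _)
        ; ∧-hom = λ x y → ≡.trans (P.≈-cong (H.∧-hom x y)) (P.∧-hom _ _)
        ; ¬-hom = λ x → ≡.trans (P.≈-cong (H.¬-hom x)) (P.¬-hom _)
        ; ⊤-hom = ≡.trans (P.≈-cong H.⊤-hom) P.⊤-hom
        ; ⊥-hom = ≡.trans (P.≈-cong H.⊥-hom) P.⊥-hom
        }
      }
      where
      module P = Point p
      module H = IsBoolHom hom

  -- The dual of `aut`. Along the walk to be built, `T p` plays the role of the predecessor of `p`.
  T : Point 𝕊 → Point 𝕊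
  T = compose {𝕊} aut aut-hom

  restrict : ∀ {𝕋} → Embedding 𝕋 𝕊 → Point 𝕊 → Point 𝕋
  restrict ι = compose (Embedding.map ι) (Embedding.hom ι)

  module _ (p : Point 𝕊) where
    open Point p hiding (at)

    ≤-at : ∀ {x y} → x ≤ y → at p x ≡ true → at p y ≡ true
    ≤-at x≤y px = proj₂ (∧-true (≡.trans (≡.trans (≡.sym (∧-hom _ _)) (≡.sym (≈-cong x≤y))) px))

    ∧-at : ∀ {x y} → at p x ≡ true → at p y ≡ true → at p (x ∧ y) ≡ true
    ∧-at px py = ≡.trans (∧-hom _ _) (cong₂ _∧ᵇ_ px py)

    at⇒≉⊥ : ∀ {x} → at p x ≡ true → Not (x ≈ ⊥)
    at⇒≉⊥ px x≈⊥ = true≢false px (≡.trans (≈-cong x≈⊥) ⊥-hom)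

    join-at : ∀ {n} (f : Fin n → Carrier) → at p (join f) ≡ true → ∃[ i ] at p (f i) ≡ true
    join-at {zero}  f pf = ⊥-elim (true≢false pf ⊥-hom)
    join-at {suc n} f pf with at p (f Fin.zero) in eq
    ... | true  = Fin.zero , eq
    ... | false with join-at (λ i → f (Fin.suc i))
                       (≡.trans (≡.sym (≡.trans (∨-hom _ _) (cong (_∨ᵇ at p (join (λ i → f (Fin.suc i)))) eq))) pf)
    ...   | i , pi = Fin.suc i , pi

  fromMeets : (f : Carrier → Bool) → (∀ {x y} → x ≈ y → f x ≡ f y) → (∀ x y → f (x ∧ y) ≡ f x ∧ᵇ f y) →
              (∀ x → f (¬ x) ≡ not (f x)) → f ⊤ ≡ true → Point 𝕊
  fromMeets f f-cong f-∧ f-¬ f-⊤ = record { at = f ; at-hom = record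
    { ≈-cong = f-cong ; ∧-hom = f-∧ ; ¬-hom = f-¬ ; ⊤-hom = f-⊤
    ; ⊥-hom = ≡.trans (f-cong (sym ¬⊤≈⊥)) (≡.trans (f-¬ ⊤) (cong not f-⊤))
    ; ∨-hom = λ x y → begin
        f (x ∨ y)                ≡⟨ f-cong (¬-involutive (x ∨ y)) ⟨
        f (¬ ¬ (x ∨ y))          ≡⟨ f-¬ _ ⟩
        not (f (¬ (x ∨ y)))      ≡⟨ cong not (f-cong (deMorgan₂ x y)) ⟩
        not (f (¬ x ∧ ¬ y))      ≡⟨ cong not (≡.trans (f-∧ _ _) (cong₂ _∧ᵇ_ (f-¬ x) (f-¬ y))) ⟩
        not (not (f x) ∧ᵇ not (f y)) ≡⟨ lemma (f x) (f y) ⟩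
        f x ∨ᵇ f y               ∎ } }
    where
    open ≡.≡-Reasoning
    open BooleanAlgebraProperties alg using (deMorgan₂; ¬⊤≈⊥)
    lemma : ∀ a b → not (not a ∧ᵇ not b) ≡ a ∨ᵇ b
    lemma true  b = ≡.refl
    lemma false b = Boolₚ.not-involutive b

-- Lets partitions of 𝔹 itself be treated by the theory for algebras embedded in 𝔹.
identity : (𝕊 : DynSys) → Embedding 𝕊 𝕊
identity 𝕊 = record
  { map = λ x → x
  ; hom = record { ≈-cong = λ e → e ; ∨-hom = λ _ _ → refl ; ∧-hom = λ _ _ → refl
                 ; ¬-hom = λ _ → refl ; ⊤-hom = refl ; ⊥-hom = refl }
  ; inj = λ e → e
  ; commute = λ _ → refl
  }
  where open DynSys 𝕊

-- Finite selection, and ultrafilters of countable algebras.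

module Classical (em : ExcludedMiddle 0ℓ) where

  -- Members of a partition must be nonzero, so after a refinement the inhabited cells are selected
  -- and numbered afresh.
  enumerate : ∀ {n} (P : Fin n → Set) → ∃[ m ] Σ (Fin m → Fin n) λ g →
    (∀ {i j} → g i ≡ g j → i ≡ j) × (∀ i → P (g i)) × (∀ j → P j → ∃[ i ] g i ≡ j)
  enumerate {zero}  P = zero , (λ ()) , (λ { {()} }) , (λ ()) , λ ()
  enumerate {suc n} P with enumerate (λ i → P (Fin.suc i)) | em {P Fin.zero}
  ... | m , g , g-inj , g-P , g-onto | no ¬P₀ =
    m , (λ i → Fin.suc (g i)) , (λ e → g-inj (Finₚ.suc-injective e)) , g-P
      , λ { Fin.zero P₀ → contradiction P₀ ¬P₀
          ; (Fin.suc j) Pj → let i , e = g-onto j Pj in i , cong Fin.suc e }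
  ... | m , g , g-inj , g-P , g-onto | yes P₀ = suc m , h , h-inj
      , (λ { Fin.zero → P₀ ; (Fin.suc i) → g-P i })
      , λ { Fin.zero _ → Fin.zero , ≡.refl
          ; (Fin.suc j) Pj → let i , e = g-onto j Pj in Fin.suc i , cong Fin.suc e }
    where
    h : Fin (suc m) → Fin (suc n)
    h Fin.zero    = Fin.zero
    h (Fin.suc i) = Fin.suc (g i)
    h-inj : ∀ {i j} → h i ≡ h j → i ≡ j
    h-inj {Fin.zero}  {Fin.zero}  e = ≡.refl
    h-inj {Fin.suc i} {Fin.suc j} e = cong Fin.suc (g-inj (Finₚ.suc-injective e))

  module Ultrafilter (𝕊 : DynSys) (countable : Countable 𝕊) where
    open Order 𝕊

    private
      enum = proj₁ countable

      Nonzero = Σ Carrier λ c → Not (c ≈ ⊥)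

      decide : Nonzero → Carrier → Nonzero
      decide (c , c≉⊥) e with em {c ∧ e ≈ ⊥}
      ... | no  ≉⊥ = c ∧ e , ≉⊥
      ... | yes ≈⊥ = c ∧ ¬ e , λ ≈⊥' → c≉⊥ (x≤⊥⇒x≈⊥ (≤-trans (∧-greatest ≤-refl (x∧¬y≈⊥⇒x≤y ≈⊥')) (≤-reflexive ≈⊥)))

      decide-≤ : ∀ c e → proj₁ (decide c e) ≤ proj₁ c
      decide-≤ (c , _) e with em {c ∧ e ≈ ⊥}
      ... | no  _ = x∧y≤x _ _
      ... | yes _ = x∧y≤x _ _

      decide-decides : ∀ c e → proj₁ (decide c e) ≤ e ⊎ proj₁ (decide c e) ≤ ¬ e
      decide-decides (c , _) e with em {c ∧ e ≈ ⊥}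
      ... | no  _ = inj₁ (x∧y≤y _ _)
      ... | yes _ = inj₂ (x∧y≤y _ _)

    module _ (x : Carrier) (x≉⊥ : Not (x ≈ ⊥)) where
      private
        chain : ℕ → Nonzero
        chain zero    = x , x≉⊥
        chain (suc n) = decide (chain n) (enum n)

        c : ℕ → Carrier
        c n = proj₁ (chain n)

        c-antitone : ∀ {m n} → m ℕ.≤′ n → c n ≤ c m
        c-antitone (ℕ.≤′-reflexive ≡.refl) = ≤-refl
        c-antitone {n = suc n} (ℕ.≤′-step m≤n) = ≤-trans (decide-≤ (chain n) (enum n)) (c-antitone m≤n)

        F : Carrier → Set
        F y = ∃[ n ] c n ≤ y

        F-∧ : ∀ {y z} → F y → F z → F (y ∧ z)
        F-∧ (m , p) (n , q) = m ℕ.⊔ n , ∧-greatest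
          (≤-trans (c-antitone (ℕₚ.≤⇒≤′ (ℕₚ.m≤m⊔n m n))) p)
          (≤-trans (c-antitone (ℕₚ.≤⇒≤′ (ℕₚ.m≤n⊔m m n))) q)

        F-≤ : ∀ {y z} → y ≤ z → F y → F z
        F-≤ y≤z (n , p) = n , ≤-trans p y≤z

        F-proper : ∀ {y} → F y → F (¬ y) → Empty
        F-proper {y} p q =
          let n , r = F-≤ (≤-reflexive (∧-complementʳ y)) (F-∧ p q)
          in proj₂ (chain n) (x≤⊥⇒x≈⊥ r)

        F-decides : ∀ y → F y ⊎ F (¬ y)
        F-decides y with proj₂ countable y
        ... | n , e with decide-decides (chain n) (enum n)
        ...   | inj₁ r = inj₁ (suc n , ≤-trans r (≤-reflexive e))
        ...   | inj₂ r = inj₂ (suc n , ≤-trans r (≤-reflexive (¬-cong e)))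

        member : Carrier → Bool
        member y = does (em {F y})

        F⇒ : ∀ {y} → F y → member y ≡ true
        F⇒ = dec-true em

        ⇒F : ∀ {y} → member y ≡ true → F y
        ⇒F {y} e with em {F y}
        ... | yes p = p

        ¬F⇒ : ∀ y → F (¬ y) → member y ≡ false
        ¬F⇒ y q with em {F y}
        ... | yes p = ⊥-elim (F-proper p q)
        ... | no  _ = ≡.refl

        member-¬ : ∀ y → member (¬ y) ≡ not (member y)
        member-¬ y with F-decides y
        ... | inj₂ q = ≡.trans (F⇒ q) (cong not (≡.sym (¬F⇒ y q)))
        ... | inj₁ p = ≡.trans (¬F⇒ (¬ y) (F-≤ (≤-reflexive (sym (¬-involutive y))) p)) (cong not (≡.sym (F⇒ p)))

      -- Starting from `x`, a descending chain of nonzero elements decides the enumerated elements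
      -- one by one. By countability every element is decided at some step, so the upward closure of
      -- the chain is an ultrafilter.
      pointIn : Σ (Point 𝕊) λ p → at p x ≡ true
      pointIn = fromMeets member
          (λ e → true-ext (λ p → F⇒ (F-≤ (≤-reflexive e) (⇒F p))) (λ p → F⇒ (F-≤ (≤-reflexive (sym e)) (⇒F p))))
          (λ y z → true-ext
            (λ p → cong₂ _∧ᵇ_ (F⇒ (F-≤ (x∧y≤x _ _) (⇒F p))) (F⇒ (F-≤ (x∧y≤y _ _) (⇒F p))))
            (λ p → let py , pz = ∧-true p in F⇒ (F-∧ (⇒F py) (⇒F pz))))
          member-¬ (F⇒ (0 , x≤⊤))
        , F⇒ (0 , ≤-refl)

    pointless⇒≈⊥ : ∀ {x} → (∀ p → at p x ≡ true → Empty) → x ≈ ⊥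
    pointless⇒≈⊥ none = em⇒dne em λ x≉⊥ → let p , px = pointIn _ x≉⊥ in none p px

    points-reflect-≤ : ∀ {x y} → (∀ p → at p x ≡ true → at p y ≡ true) → x ≤ y
    points-reflect-≤ le = x∧¬y≈⊥⇒x≤y (pointless⇒≈⊥ λ p px∧¬y →
      let px , p¬y = ∧-true (≡.trans (≡.sym (Point.∧-hom p _ _)) px∧¬y)
      in true≢false p¬y (≡.trans (Point.¬-hom p _) (cong not (le p px))))

digit : Bool → Fin 2
digit true  = Fin.zero
digit false = Fin.suc Fin.zero

digit-injective : ∀ {a b} → digit a ≡ digit b → a ≡ b
digit-injective {true}  {true}  _ = ≡.refl
digit-injective {false} {false} _ = ≡.refl

-- Partitions seen through the points of 𝔹.

module Labellings (em : ExcludedMiddle 0ℓ) {𝔹 : DynSys} (countable : Countable 𝔹)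
                  {𝕊 : DynSys} (ι : Embedding 𝕊 𝔹) where
  open Order 𝕊
  open Classical em
  open Ultrafilter 𝔹 countable
  private
    module B = Order 𝔹
    module ι = Embedding ι
    module ιh = IsBoolHom ι.hom

  -- Elements of 𝕊 are tested at points of 𝔹, so that partitions of both algebras can be compared at
  -- one and the same point.
  ev : Point 𝔹 → Carrier → Bool
  ev p = at (restrict ι p)

  ev-T : ∀ p x → ev p (aut x) ≡ ev (T p) x
  ev-T p x = Point.≈-cong p (ι.commute x)

  pointIn′ : ∀ {x} → Not (x ≈ ⊥) → ∃[ p ] ev p x ≡ true
  pointIn′ x≉⊥ = pointIn _ λ ιx≈⊥ → x≉⊥ (ι.inj (B.trans ιx≈⊥ (B.sym ιh.⊥-hom)))

  ev-reflects-≤ : ∀ {x y} → (∀ p → ev p x ≡ true → ev p y ≡ true) → x ≤ y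
  ev-reflects-≤ le = ι.inj (B.trans (points-reflect-≤ le) (B.sym (ιh.∧-hom _ _)))

  -- `lab` sends a point to the member containing it; `rep` picks a point of each member and thereby
  -- encodes that members are nonzero.
  record Labelling {n} (x : Fin n → Carrier) : Set where
    field
      lab        : Point 𝔹 → Fin n
      lab-at     : ∀ p → ev p (x (lab p)) ≡ true
      lab-unique : ∀ p {i} → ev p (x i) ≡ true → lab p ≡ i
      rep        : Fin n → Point 𝔹
      lab-rep    : ∀ i → lab (rep i) ≡ i

    ∈-rep : ∀ i → ev (rep i) (x i) ≡ true
    ∈-rep i = subst (λ j → ev (rep i) (x j) ≡ true) (lab-rep i) (lab-at (rep i))

    isPartition : IsPartition 𝕊 x
    isPartition
      = (λ i → at⇒≉⊥ (restrict ι (rep i)) (∈-rep i))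
      , (λ i j i≢j → x≤⊥⇒x≈⊥ (ev-reflects-≤ λ p px∧y →
          let px , py = ∧-true (≡.trans (≡.sym (Point.∧-hom (restrict ι p) _ _)) px∧y)
          in contradiction (≡.trans (≡.sym (lab-unique p px)) (lab-unique p py)) i≢j))
      , antisym x≤⊤ (ev-reflects-≤ λ p _ → ≤-at (restrict ι p) (join-upper x (lab p)) (lab-at p))

    -- A nonzero `aut (x i) ∧ x j` contains a point `p`, and `aut (x i)` contains `p` exactly when
    -- `x i` contains `T p`. Together with `⇒edge`, edges are the transitions from `T p` to `p`.
    edge⇒ : ∀ {i j} → PartDigraph 𝕊 x i j → ∃[ p ] lab (T p) ≡ i × lab p ≡ j
    edge⇒ i→j with pointIn′ i→j
    ... | p , px∧y =
      let px , py = ∧-true (≡.trans (≡.sym (Point.∧-hom (restrict ι p) _ _)) px∧y)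
      in p , lab-unique (T p) (≡.trans (≡.sym (ev-T p _)) px) , lab-unique p py

    ⇒edge : ∀ p → PartDigraph 𝕊 x (lab (T p)) (lab p)
    ⇒edge p = at⇒≉⊥ (restrict ι p) (∧-at (restrict ι p) (≡.trans (ev-T p _) (lab-at (T p))) (lab-at p))

    connected : Incompressible 𝕊 → StronglyConnected (PartDigraph 𝕊 x)
    connected inc = PartitionDigraph.stronglyConnected 𝕊 isPartition (λ _ _ → em) inc (λ _ _ → em)

    union : ∀ (b : Fin n → Bool) → ∃[ y ] ∀ p → ev p y ≡ b (lab p)
    union b = join f , λ p → true-ext (sound p) (complete p)
      where
      f : Fin n → Carrier
      f i = if b i then x i else ⊥
      sound : ∀ p → ev p (join f) ≡ true → b (lab p) ≡ true
      sound p py with join-at (restrict ι p) f py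
      ... | i , pfi with b i in bi
      ...   | true  = ≡.trans (cong b (lab-unique p pfi)) bi
      ...   | false = ⊥-elim (true≢false pfi (Point.⊥-hom (restrict ι p)))
      complete : ∀ p → b (lab p) ≡ true → ev p (join f) ≡ true
      complete p blab = ≤-at (restrict ι p) (join-upper f (lab p))
        (≡.trans (cong (λ c → ev p (if c then x (lab p) else ⊥)) blab) (lab-at p))

  open Labelling

  fromPartition : ∀ {n} {x : Fin n → Carrier} → IsPartition 𝕊 x → Labelling x
  fromPartition {n} {x} (nonzero , disjoint , covers) = record
    { lab = λ p → proj₁ (found p)
    ; lab-at = λ p → proj₂ (found p)
    ; lab-unique = unique
    ; rep = λ i → proj₁ (pointIn′ (nonzero i))
    ; lab-rep = λ i → let p , px = pointIn′ (nonzero i) in unique p px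
    }
    where
    found : ∀ p → ∃[ i ] ev p (x i) ≡ true
    found p = join-at (restrict ι p) x (≡.trans (Point.≈-cong (restrict ι p) covers) (Point.⊤-hom (restrict ι p)))
    unique : ∀ p {i} → ev p (x i) ≡ true → proj₁ (found p) ≡ i
    unique p {i} pi with found p
    ... | j , pj with j Fin.≟ i
    ...   | yes j≡i = j≡i
    ...   | no  j≢i = ⊥-elim (at⇒≉⊥ (restrict ι p) (∧-at (restrict ι p) pj pi) (disjoint j i j≢i))

  trivial : Point 𝔹 → Labelling {1} (λ _ → ⊤)
  trivial p₀ = record
    { lab = λ _ → Fin.zero ; lab-at = λ p → Point.⊤-hom (restrict ι p) ; lab-unique = λ { p {Fin.zero} _ → ≡.refl }
    ; rep = λ _ → p₀ ; lab-rep = λ { Fin.zero → ≡.refl } }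

  dropEmpty : ∀ {n} {x : Fin n → Carrier} (κ : Point 𝔹 → Fin n) → (∀ p → ev p (x (κ p)) ≡ true) →
              (∀ p {i} → ev p (x i) ≡ true → κ p ≡ i) →
              ∃[ m ] Σ (Fin m → Fin n) λ g → Σ (Labelling (λ i → x (g i))) λ L → ∀ p → g (lab L p) ≡ κ p
  dropEmpty {x = x} κ κ-at κ-unique with enumerate (λ i → ∃[ p ] κ p ≡ i)
  ... | m , g , g-inj , g-rep , g-onto = m , g , record
    { lab = λ p → proj₁ (onto p)
    ; lab-at = λ p → subst (λ i → ev p (x i) ≡ true) (≡.sym (proj₂ (onto p))) (κ-at p)
    ; lab-unique = λ p pi → g-inj (≡.trans (proj₂ (onto p)) (κ-unique p pi))
    ; rep = λ i → proj₁ (g-rep i)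
    ; lab-rep = λ i → g-inj (≡.trans (proj₂ (onto _)) (proj₂ (g-rep i)))
    } , λ p → proj₂ (onto p)
    where
    onto : ∀ p → ∃[ i ] g i ≡ κ p
    onto p = g-onto (κ p) (p , ≡.refl)

  -- By `decides`, each element of `u` is constant on each cell, so its bit there can be read off at
  -- any point of the cell.
  record Refinement {n} {x : Fin n → Carrier} (L : Labelling x) (u : List Carrier) : Set where
    field
      {size}    : ℕ
      {part}    : Fin size → Carrier
      labelling : Labelling part
      π         : Fin size → Fin n
      lab-π     : ∀ p → lab L p ≡ π (lab labelling p)
      decides   : ∀ {y} → y ∈ u → ∀ p q → lab labelling p ≡ lab labelling q → ev p y ≡ ev q y

  -- The cells are the meets of members with `y` or `¬ y`, numbered by pairs; those without points
  -- are discarded.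
  split : ∀ {n} {x : Fin n → Carrier} (L : Labelling x) y → Refinement L (y ∷ [])
  split {n} {x} L y = record
    { labelling = L'
    ; π = λ i → proj₁ (remQuot {n} 2 (g i))
    ; lab-π = λ p → ≡.sym
        (≡.trans (cong (λ i → proj₁ (remQuot {n} 2 i)) (g-lab p)) (cong proj₁ (Finₚ.remQuot-combine (lab L p) _)))
    ; decides = λ { (here ≡.refl) p q e → digit-injective
        (proj₂ (Finₚ.combine-injective (lab L p) (digit (ev p y)) (lab L q) (digit (ev q y))
            (≡.trans (≡.sym (g-lab p)) (≡.trans (cong g e) (g-lab q))))) }
    }
    where
    literal : Fin 2 → Carrier
    literal Fin.zero    = y
    literal (Fin.suc _) = ¬ y
    literal-at : ∀ p → ev p (literal (digit (ev p y))) ≡ true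
    literal-at p with ev p y in py
    ... | true  = py
    ... | false = ≡.trans (Point.¬-hom (restrict ι p) y) (cong not py)
    literal-unique : ∀ p {s} → ev p (literal s) ≡ true → digit (ev p y) ≡ s
    literal-unique p {Fin.zero} py = cong digit py
    literal-unique p {Fin.suc Fin.zero} py = cong digit
      (≡.trans (≡.sym (Boolₚ.not-involutive _)) (cong not (≡.trans (≡.sym (Point.¬-hom (restrict ι p) y)) py)))
    cell : Fin n × Fin 2 → Carrier
    cell (i , s) = x i ∧ literal s
    κ : Point 𝔹 → Fin (n ℕ.* 2)
    κ p = combine (lab L p) (digit (ev p y))
    κ-at : ∀ p → ev p (cell (remQuot {n} 2 (κ p))) ≡ true
    κ-at p = ≡.trans (cong (λ t → ev p (cell t)) (Finₚ.remQuot-combine (lab L p) (digit (ev p y))))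
                     (∧-at (restrict ι p) (lab-at L p) (literal-at p))
    κ-unique : ∀ p {i} → ev p (cell (remQuot {n} 2 i)) ≡ true → κ p ≡ i
    κ-unique p {i} pc =
      let px , pl = ∧-true (≡.trans (≡.sym (Point.∧-hom (restrict ι p) _ _)) pc)
      in ≡.trans (cong₂ combine (lab-unique L p px) (literal-unique p pl)) (Finₚ.combine-remQuot {n} 2 i)
    dropped = dropEmpty {x = λ i → cell (remQuot {n} 2 i)} κ κ-at κ-unique
    g = proj₁ (proj₂ dropped)
    L' = proj₁ (proj₂ (proj₂ dropped))
    g-lab = proj₂ (proj₂ (proj₂ dropped))

  refine : ∀ {n} {x : Fin n → Carrier} (L : Labelling x) u → Refinement L u
  refine L [] = record { labelling = L ; π = λ i → i ; lab-π = λ _ → ≡.refl ; decides = λ () }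
  refine L (y ∷ u) = record
    { labelling = S.labelling
    ; π = λ i → R.π (S.π i)
    ; lab-π = λ p → ≡.trans (R.lab-π p) (cong R.π (S.lab-π p))
    ; decides = λ { (here ≡.refl) p q e → S.decides (here ≡.refl) p q e
                  ; (there y∈u) p q e → R.decides y∈u p q
                      (≡.trans (S.lab-π p) (≡.trans (cong S.π e) (≡.sym (S.lab-π q)))) }
    }
    where
    module R = Refinement (refine L u)
    module S = Refinement (split R.labelling y)

module _ (em : ExcludedMiddle 0ℓ) {𝔹 : DynSys} (countable : Countable 𝔹)
         {𝕊 𝕊' : DynSys} (ι : Embedding 𝕊 𝔹) (ι' : Embedding 𝕊' 𝔹) where
  private
    module L = Labellings em countable ι
    module L' = Labellings em countable ι'

  -- Every edge of either digraph comes from a point and its image under `T`; labelling these two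
  -- points in the other partition transports the edge.
  refinement-epi : ∀ {n m} {x : Fin n → DynSys.Carrier 𝕊} {x' : Fin m → DynSys.Carrier 𝕊'}
                   (l : L.Labelling x) (l' : L'.Labelling x') (π : Fin m → Fin n) →
                   (∀ p → L.Labelling.lab l p ≡ π (L'.Labelling.lab l' p)) →
                   IsEpi (PartDigraph 𝕊' x') (PartDigraph 𝕊 x) π
  refinement-epi {x = x} l l' π lab-π =
      (λ i → l'.lab (l.rep i) , ≡.trans (≡.sym (lab-π _)) (l.lab-rep i))
    , λ i j →
        (λ i→j → let p , pi , pj = l.edge⇒ i→j in
          l'.lab (T p) , l'.lab p , ≡.trans (≡.sym (lab-π _)) pi , ≡.trans (≡.sym (lab-π _)) pj , l'.⇒edge p)
      , λ { (i' , j' , ≡.refl , ≡.refl , i'→j') → let p , pi , pj = l'.edge⇒ i'→j' in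
            subst₂ (PartDigraph 𝕊 x) (≡.trans (lab-π _) (cong π pi)) (≡.trans (lab-π _) (cong π pj)) (l.⇒edge p) }
    where
    module l = L.Labelling l
    module l' = L'.Labelling l'

-- Imitation of finite tuples of 𝔹 by tuples of 𝔸.

module Saturation (em : ExcludedMiddle 0ℓ) {𝔸 𝔹 : DynSys} (countable : Countable 𝔹) (inc : Incompressible 𝔹)
                  (ι : Embedding 𝔸 𝔹) (polarized : Polarized 𝔸) (p₀ : Point 𝔹) where
  private
    module A = Order 𝔸
    module B = Order 𝔹
    module LA = Labellings em countable ι
    module LB = Labellings em countable (identity 𝔹)
    open LA.Labelling
  open LA using (ev) public

  Agree : List A.Carrier → Point 𝔹 → Point 𝔹 → Set
  Agree u p q = ∀ {x} → x ∈ u → ev p x ≡ ev q x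

  module _ (e : ℕ → B.Carrier) (n : ℕ) where

    -- The predecessors of `p` and `q` are compared too, so a match concerns an edge of the digraph
    -- and not merely a vertex.
    record Match (u : List A.Carrier) (w : ℕ → A.Carrier) (p q : Point 𝔹) : Set where
      field
        agree : Agree u p q
        now   : ∀ {i} → i ℕ.< n → ev p (w i) ≡ at q (e i)
        prev  : ∀ {i} → i ℕ.< n → ev (T p) (w i) ≡ at (T q) (e i)

    record Realization (u : List A.Carrier) : Set where
      field
        w     : ℕ → A.Carrier
        forth : ∀ p → ∃[ q ] Match u w p q
        back  : ∀ q → ∃[ p ] Match u w p q

    module Realize (u : List A.Carrier) where
      open LA.Refinement (LA.refine (LA.trivial p₀) u) using () renaming
          (part to a; labelling to 𝒜; decides to 𝒜-decides)

      ι𝒜 : LB.Labelling (λ i → Embedding.map ι (a i))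
      ι𝒜 = record { lab = lab 𝒜 ; lab-at = lab-at 𝒜 ; lab-unique = lab-unique 𝒜 ; rep = rep 𝒜 ; lab-rep = lab-rep 𝒜 }

      open LB.Refinement (LB.refine ι𝒜 (applyUpTo e n)) using () renaming
        (part to b; labelling to ℬ; π to φ; lab-π to lab-φ; decides to ℬ-decides)

      a≥⇒lab : ∀ {m} {a' : Fin m → A.Carrier} (L' : LA.Labelling a') {π : Fin m → Fin _} → IsNaturalMap 𝔸 a' a π →
               ∀ p → lab 𝒜 p ≡ π (lab L' p)
      a≥⇒lab L' nat p = lab-unique 𝒜 p (≤-at (restrict ι p) (A.sym (nat _)) (lab-at L' p))

      -- The points `T p` and `p` give an edge of one digraph, the isomorphism carries it to the
      -- other, and there it comes from a point again. This yields `forth` and, in reverse, `back`.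
      fromRealization : ∀ {m} (a' : Fin m → A.Carrier) → Realizes 𝔸 a (PartDigraph 𝔹 b) φ a' → Realization u
      fromRealization {m} a' (part , π , nat , ψ , (ψ-inj , ψ-onto , iso) , πψ) = record
        { w = w
        ; forth = λ p →
            let i = proj₂ (ψ-onto (lab L' (T p)))
                j = proj₂ (ψ-onto (lab L' p))
                q , qi , qj = ℬ.edge⇒ (proj₂ (iso _ _) (subst₂ (PartDigraph 𝔸 a') (≡.sym i) (≡.sym j) (⇒edge L' p)))
            in q , match p q (≡.trans (cong ψ qj) j) (≡.trans (cong ψ qi) i)
        ; back = λ q →
            let p , pi , pj = edge⇒ L' (proj₁ (iso _ _) (ℬ.⇒edge q))
            in p , match p q (≡.sym pj) (≡.sym pi)
        }
        where
        module ℬ = LB.Labelling ℬ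
        L' : LA.Labelling a'
        L' = LA.fromPartition part
        -- Each realizing cell receives the bit of `e j` at the representative of the corresponding
        -- cell of `ℬ`; for `j < n` any other point of that cell would give the same bit.
        w-spec : ∀ j → ∃[ y ] ∀ p → ev p y ≡ at (ℬ.rep (proj₁ (ψ-onto (lab L' p)))) (e j)
        w-spec j = union L' λ l → at (ℬ.rep (proj₁ (ψ-onto l))) (e j)
        w : ℕ → A.Carrier
        w j = proj₁ (w-spec j)
        w-at : ∀ p q → ψ (ℬ.lab q) ≡ lab L' p → ∀ {i} → i ℕ.< n → ev p (w i) ≡ at q (e i)
        w-at p q e' {i} i<n = ≡.trans (proj₂ (w-spec i) p) (ℬ-decides (∈-applyUpTo⁺ e i<n) _ q
          (≡.trans (ℬ.lab-rep _) (ψ-inj (≡.trans (proj₂ (ψ-onto (lab L' p))) (≡.sym e')))))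
        match : ∀ p q → ψ (ℬ.lab q) ≡ lab L' p → ψ (ℬ.lab (T q)) ≡ lab L' (T p) → Match u w p q
        match p q now prev = record
          { agree = λ x∈u → 𝒜-decides x∈u p q (≡.trans (a≥⇒lab L' nat p)
              (≡.trans (cong π (≡.sym now)) (≡.trans (πψ _) (≡.sym (lab-φ q)))))
          ; now = w-at p q now
          ; prev = w-at (T p) (T q) prev
          }

      -- The common refinement in 𝔹 of `b` and the image of `a'` is an amalgam; it is strongly
      -- connected because 𝔹 is incompressible.
      compatible : ∀ {m} (a' : Fin m → A.Carrier) → IsPartition 𝔸 a' → ∀ {π} → IsNaturalMap 𝔸 a' a π →
                   Compatible (PartDigraph 𝔹 b) (PartDigraph 𝔸 a') (PartDigraph 𝔸 a) φ π
      compatible {m} a' part {π} nat = _ , PartDigraph 𝔹 R.part , ℛ.connected inc , R.π , ψ̄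
        , refinement-epi em countable (identity 𝔹) (identity 𝔹) ℬ R.labelling R.π R.lab-π
        , refinement-epi em countable ι (identity 𝔹) L' R.labelling ψ̄ lab-ψ̄
        , λ i → let r = ℛ.rep i in
            ≡.trans (cong φ (≡.trans (cong R.π (≡.sym (ℛ.lab-rep i))) (≡.sym (R.lab-π r))))
                    (≡.trans (≡.sym (lab-φ r)) (a≥⇒lab L' nat r))
        where
        L' : LA.Labelling a'
        L' = LA.fromPartition part
        module R = LB.Refinement (LB.refine ℬ (tabulate λ i → Embedding.map ι (a' i)))
        module ℛ = LB.Labelling R.labelling
        -- All images of the `a' i` are decided by the refinement, so the label in `L'` is constant
        -- on each cell and a representative determines it.
        ψ̄ : Fin R.size → Fin m
        ψ̄ i = lab L' (ℛ.rep i)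
        lab-ψ̄ : ∀ p → lab L' p ≡ ψ̄ (ℛ.lab p)
        lab-ψ̄ p = ≡.sym (lab-unique L' (ℛ.rep (ℛ.lab p))
            (≡.trans (R.decides (∈-tabulate⁺ (lab L' p)) _ p (ℛ.lab-rep _)) (lab-at L' p)))

      realization : Realization u
      realization = conclude (polarized _ a (isPartition 𝒜) _ (PartDigraph 𝔹 b) φ
          (LB.Labelling.connected ℬ inc , refinement-epi em countable ι (identity 𝔹) 𝒜 ℬ φ lab-φ))
        where
        conclude : IsPolarizedVR 𝔸 a (PartDigraph 𝔹 b) φ → Realization u
        conclude (inj₁ (_ , a' , realizes)) = fromRealization a' realizes
        conclude (inj₂ (_ , a' , part , π , nat , incompatible)) = ⊥-elim (incompatible (compatible a' part nat))

-- Bit vectors, and properties holding eventually or infinitely often.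

encode : ∀ n → (ℕ → Bool) → Fin (2 ℕ.^ n)
encode zero    f = Fin.zero
encode (suc n) f = combine (digit (f n)) (encode n f)

encode-injective : ∀ n {f g} → encode n f ≡ encode n g → ∀ {i} → i ℕ.< n → f i ≡ g i
encode-injective (suc n) {f} {g} e {i} i<1+n
  with Finₚ.combine-injective (digit (f n)) (encode n f) (digit (g n)) (encode n g) e | ℕₚ.m<1+n⇒m<n∨m≡n i<1+n
... | _  , e' | inj₁ i<n    = encode-injective n e' i<n
... | e' , _  | inj₂ ≡.refl = digit-injective e'

Eventually : (ℕ → Set) → Set
Eventually P = ∃[ N ] ∀ k → N ℕ.≤ k → P k

Frequently : (ℕ → Set) → Set
Frequently P = ∀ N → ∃[ k ] N ℕ.≤ k × P k

infixr 2 _⊗_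
_⊗_ : ∀ {P Q} → Eventually P → Eventually Q → Eventually (λ k → P k × Q k)
(M , p) ⊗ (N , q) = M ℕ.⊔ N , λ k le →
  p k (ℕₚ.≤-trans (ℕₚ.m≤m⊔n M N) le) , q k (ℕₚ.≤-trans (ℕₚ.m≤n⊔m M N) le)

eventually-map : ∀ {P Q} → (∀ k → P k → Q k) → Eventually P → Eventually Q
eventually-map f (N , p) = N , λ k le → f k (p k le)

eventually-∀< : ∀ {P : ℕ → ℕ → Set} → (∀ i → Eventually (P i)) → ∀ n → Eventually (λ k → ∀ i → i ℕ.< n → P i k)
eventually-∀< ev zero = 0 , λ _ _ _ ()
eventually-∀< ev (suc n) = eventually-map
  (λ { k (p , q) i i<1+n → [ p i , (λ { ≡.refl → q }) ]′ (ℕₚ.m<1+n⇒m<n∨m≡n i<1+n) })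
  (eventually-∀< ev n ⊗ ev n)

-- Realizations that coincide with the imitated tuple at a point.

module Alignment (em : ExcludedMiddle 0ℓ) {𝔸 𝔹 : DynSys} (countable : Countable 𝔹) (inc : Incompressible 𝔹)
                 (ι : Embedding 𝔸 𝔹) (polarized : Polarized 𝔸) (p₀ : Point 𝔹) where
  open Saturation em countable inc ι polarized p₀ public
  private
    module A = Order 𝔸
    module B = Order 𝔹

  module _ (e : ℕ → B.Carrier) (n : ℕ) where

    record Aligned (u : List A.Carrier) : Set where
      field
        realizing : Realization e n u
      open Realization realizing public
      field
        common    : Point 𝔹
        coincide  : ∀ {i} → i ℕ.< n → ev common (w i) ≡ at common (e i)

    -- Otherwise realize e repeatedly, each time over the earlier realizations: the bit vectors of these
    -- realizations at p₀ are then pairwise distinct, but there are only 2 ^ n bit vectors.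
    abstract
      align : ∀ u → Aligned u
      align u = em⇒dne em λ misaligned → collision misaligned (Finₚ.pigeonhole (ℕₚ.n<1+n (2 ℕ.^ n)) bits)
        where
        U : ℕ → List A.Carrier
        R : ∀ j → Realization e n (U j)
        U zero    = u
        U (suc j) = applyUpTo (Realization.w (R j)) n ++ U j
        R j = Realize.realization e n (U j)

        U-mono : ∀ i j → i ℕ.≤′ j → ∀ {x} → x ∈ U i → x ∈ U j
        U-mono i j (ℕ.≤′-reflexive ≡.refl) x∈ = x∈
        U-mono i (suc j) (ℕ.≤′-step i≤j) x∈ = ∈-++⁺ʳ (applyUpTo (Realization.w (R j)) n) (U-mono i j i≤j x∈)

        weaken : ∀ {w} j {p q} → Match e n (U j) w p q → Match e n u w p q
        weaken j m = record { agree = λ x∈u → Match.agree m (U-mono 0 j (ℕₚ.≤⇒≤′ ℕ.z≤n) x∈u)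
                          ; now = Match.now m ; prev = Match.prev m }

        bits : Fin (suc (2 ℕ.^ n)) → Fin (2 ℕ.^ n)
        bits i = encode n λ k → ev p₀ (Realization.w (R (Fin.toℕ i)) k)

        collision : Not (Aligned u) → Not (∃[ i ] ∃[ j ] i Fin.< j × bits i ≡ bits j)
        collision misaligned (i , j , i<j , same) = misaligned (record
          { realizing = record
            { w = Rᵢ.w
            ; forth = λ p → let q , m = Rᵢ.forth p in q , weaken (Fin.toℕ i) m
            ; back  = λ q → let p , m = Rᵢ.back q in p , weaken (Fin.toℕ i) m
            }
          -- The later realization works over the earlier tuple, which therefore has the same bits
          -- here as at `p₀`. Those equal the bits of the later tuple at `p₀`, and these match `e`
          -- here.
          ; common = proj₁ (Rⱼ.forth p₀)
          ; coincide = λ k<n → ≡.trans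
              (≡.sym (M.agree (U-mono (suc (Fin.toℕ i)) (Fin.toℕ j) (ℕₚ.≤⇒≤′ i<j) (∈-++⁺ˡ (∈-applyUpTo⁺ Rᵢ.w k<n)))))
              (≡.trans (encode-injective n same k<n) (M.now k<n))
          })
          where
          module Rᵢ = Realization (R (Fin.toℕ i))
          module Rⱼ = Realization (R (Fin.toℕ j))
          module M = Match (proj₂ (Rⱼ.forth p₀))

-- Finite patterns in the sets chosen by `η`.

module Traces (em : ExcludedMiddle 0ℓ) {𝔸 𝔹 : DynSys} (countable : Countable 𝔹) (ι : Embedding 𝔸 𝔹)
    (η : Embedding 𝔸 PωFinσ) where
  open Labellings em countable ι using (ev; pointIn′)
  open Order 𝔸
  private
    module P = DynSys PωFinσ
    module η = Embedding η
    module h = IsBoolHom η.hom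

  Tracked : List Carrier → Carrier → ℕ → Set
  Tracked u c k = η.map c k ≡ true → ∃[ p ] ev p c ≡ true × (∀ {x} → x ∈ u → ev p x ≡ η.map x k)

  abstract
    -- Induction on `u`, splitting `c` by each of its elements: `η` is a homomorphism modulo finite
    -- sets, so at late times the image of `c` splits likewise, and the image of `⊥` contains no
    -- late time.
    track : ∀ u c → Eventually (Tracked u c)
    track [] c with em {c ≈ ⊥}
    ... | yes c≈⊥ = eventually-map (λ k ck≡false ck → ⊥-elim (true≢false ck ck≡false))
                      (P.trans (h.≈-cong c≈⊥) h.⊥-hom)
    ... | no  c≉⊥ = 0 , λ _ _ _ → let p , pc = pointIn′ c≉⊥ in p , pc , λ ()
    track (y ∷ u) c = eventually-map step (track u (c ∧ y) ⊗ track u (c ∧ ¬ y) ⊗ h.∧-hom c y ⊗ h.∧-hom c (¬ y) ⊗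
        h.¬-hom y)
      where
      step : ∀ k → Tracked u (c ∧ y) k × Tracked u (c ∧ ¬ y) k × η.map (c ∧ y) k ≡ η.map c k ∧ᵇ η.map y k ×
                   η.map (c ∧ ¬ y) k ≡ η.map c k ∧ᵇ η.map (¬ y) k × η.map (¬ y) k ≡ not (η.map y k) →
             Tracked (y ∷ u) c k
      step k (t , f , c∧y , c∧¬y , ¬y) ck = go (η.map y k) ≡.refl
        where
        go : ∀ b → η.map y k ≡ b → ∃[ p ] ev p c ≡ true × (∀ {x} → x ∈ y ∷ u → ev p x ≡ η.map x k)
        go true yk =
          let p , pcy , agree = t (≡.trans c∧y (cong₂ _∧ᵇ_ ck yk))
              pc , py = ∧-true (≡.trans (≡.sym (Point.∧-hom (restrict ι p) c y)) pcy)
          in p , pc , λ { (here ≡.refl) → ≡.trans py (≡.sym yk) ; (there x∈u) → agree x∈u }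
        go false yk =
          let p , pcy , agree = f (≡.trans c∧¬y (cong₂ _∧ᵇ_ ck (≡.trans ¬y (cong not yk))))
              pc , p¬y = ∧-true (≡.trans (≡.sym (Point.∧-hom (restrict ι p) c (¬ y))) pcy)
          in p , pc , λ { (here ≡.refl) → ≡.trans
                  (Boolₚ.not-injective (≡.trans (≡.sym (Point.¬-hom (restrict ι p) y)) p¬y)) (≡.sym yk)
                        ; (there x∈u) → agree x∈u }

    -- Injectivity of `η` enters here: if the pattern of `p` stopped occurring, the meet describing
    -- it would be sent to `⊥`, although it contains `p`.
    visit : ∀ u c p → ev p c ≡ true → Frequently λ k → η.map c k ≡ true × (∀ {x} → x ∈ u → η.map x k ≡ ev p x)
    visit [] c p pc N = em⇒dne em λ never → at⇒≉⊥ (restrict ι p) pc (η.inj (P.trans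
      (N , λ k N≤k → Boolₚ.¬-not λ ck → never (k , N≤k , ck , λ ()))
      (P.sym h.⊥-hom)))
    visit (y ∷ u) c p pc N with ev p y in py
    ... | true =
      let M , hom = h.∧-hom c y
          k , M≤k , cy , agree = visit u (c ∧ y) p (∧-at (restrict ι p) pc py) (N ℕ.⊔ M)
          ck , yk = ∧-true (≡.trans (≡.sym (hom k (ℕₚ.m⊔n≤o⇒n≤o N M M≤k))) cy)
      in k , ℕₚ.m⊔n≤o⇒m≤o N M M≤k , ck , λ { (here ≡.refl) → ≡.trans yk (≡.sym py) ; (there x∈u) → agree x∈u }
    ... | false =
      let M , hom = h.∧-hom c (¬ y) ⊗ h.¬-hom y
          k , M≤k , cy , agree = visit u (c ∧ ¬ y) p
            (∧-at (restrict ι p) pc (≡.trans (Point.¬-hom (restrict ι p) y) (cong not py))) (N ℕ.⊔ M)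
          c∧¬y , ¬y = hom k (ℕₚ.m⊔n≤o⇒n≤o N M M≤k)
          ck , ¬yk = ∧-true (≡.trans (≡.sym c∧¬y) cy)
      in k , ℕₚ.m⊔n≤o⇒m≤o N M M≤k , ck
           , λ { (here ≡.refl) → ≡.trans (Boolₚ.not-injective (≡.trans (≡.sym ¬y) ¬yk)) (≡.sym py) ;
               (there x∈u) → agree x∈u }

-- The stages and their prescriptions.

module Extension (em : ExcludedMiddle 0ℓ) {𝔸 𝔹 : DynSys} (countable𝔸 : Countable 𝔸) (countable𝔹 : Countable 𝔹)
                 (inc : Incompressible 𝔹) (ι : Embedding 𝔸 𝔹) (η : Embedding 𝔸 PωFinσ)
                 (polarized : Polarized 𝔸) (p₀ : Point 𝔹) where
  open Alignment em countable𝔹 inc ι polarized p₀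
  open Traces em countable𝔹 ι η
  private
    module A = Order 𝔸
    module B = Order 𝔹
    module P = DynSys PωFinσ
    module ι = Embedding ι
    module η = Embedding η
    a = proj₁ countable𝔸
    e = proj₁ countable𝔹

  mutual
    -- The enumerated elements of 𝔸 force the limit to extend `η`; the tuple `w n` is included so
    -- that matches at stage `n + 1` preserve its bits, as switching stages requires.
    U : ℕ → List A.Carrier
    U zero    = []
    U (suc n) = applyUpTo a (suc n) ++ applyUpTo (w n) n

    stage : ∀ n → Aligned e n (U n)
    stage n = align e n (U n)

    w : ℕ → ℕ → A.Carrier
    w n = Aligned.w (stage n)

  -- trace n k records the bits that stage n prescribes for e 0 , … , e (n - 1) at time k.
  trace : ℕ → ℕ → ℕ → Bool
  trace n k i = η.map (w n i) k

  record Shadows (n k : ℕ) (p : Point 𝔹) : Set where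
    field
      extends : ∀ {x} → x ∈ U n → ev p x ≡ η.map x k
      follows : ∀ {i} → i ℕ.< n → at p (e i) ≡ trace n k i

  -- One point and its predecessor carry the prescriptions for `suc k` and `k`, which is what makes
  -- consecutive prescriptions respect the automorphism of 𝔹.
  record Steps (n k : ℕ) : Set where
    field
      point  : Point 𝔹
      source : ∀ {i} → i ℕ.< n → at (T point) (e i) ≡ trace n k i
      target : ∀ {i} → i ℕ.< n → at point (e i) ≡ trace n (suc k) i

  shift-trace : ∀ n → Eventually λ k → ∀ i → i ℕ.< n → η.map (A.aut (w n i)) (suc k) ≡ trace n k i
  shift-trace n = eventually-∀< (λ i → let N , eq = η.commute (w n i) in
    N , λ k N≤k → eq (suc k) (ℕₚ.m≤n⇒m≤1+n N≤k)) n

  -- At late times the bit of `aut (w n i)` is that of `w n i` one time earlier; including it lets a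
  -- single point account for two consecutive times.
  window : ℕ → List A.Carrier
  window n = U n ++ applyUpTo (w n) n ++ applyUpTo (λ i → A.aut (w n i)) n

  Realized : ℕ → ℕ → Set
  Realized n k = ∃[ p ] ∀ {x} → x ∈ window n → ev p x ≡ η.map x k

  realized : ∀ n → Eventually (Realized n)
  realized n = eventually-map forget (track (window n) A.⊤ ⊗ IsBoolHom.⊤-hom η.hom)
    where
    forget : ∀ k → Tracked (window n) A.⊤ k × η.map A.⊤ k ≡ true → Realized n k
    forget k (tracked , ⊤k) = let p , _ , agree = tracked ⊤k in p , agree

  module _ (n : ℕ) where
    open Aligned (stage n) using (forth)

    shadowed : ∀ {k} → Realized n k → ∃[ p ] Shadows n k p
    shadowed (p , agree) =
      let q , m = forth p in q , record
        { extends = λ x∈U → ≡.trans (≡.sym (Match.agree m x∈U)) (agree (∈-++⁺ˡ x∈U))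
        ; follows = λ i<n → ≡.trans (≡.sym (Match.now m i<n))
            (agree (∈-++⁺ʳ (U n) (∈-++⁺ˡ (∈-applyUpTo⁺ (w n) i<n))))
        }

    stepped : ∀ {k} → Realized n (suc k) →
              (∀ i → i ℕ.< n → η.map (A.aut (w n i)) (suc k) ≡ trace n k i) → Steps n k
    stepped (p , agree) shifted =
      let q , m = forth p in record
        { point = q
        ; source = λ {i} i<n → ≡.trans (≡.sym (Match.prev m i<n))
            (≡.trans (≡.sym (Point.≈-cong p (ι.commute (w n i))))
            (≡.trans (agree (∈-++⁺ʳ (U n)
                (∈-++⁺ʳ (applyUpTo (w n) n) (∈-applyUpTo⁺ (λ i → A.aut (w n i)) i<n)))) (shifted i i<n)))
        ; target = λ i<n → ≡.trans (≡.sym (Match.now m i<n))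
            (agree (∈-++⁺ʳ (U n) (∈-++⁺ˡ (∈-applyUpTo⁺ (w n) i<n))))
        }

  good : ∀ n → Eventually λ k → (∃[ p ] Shadows n k p) × Steps n k
  good n = eventually-map (λ { k (now , next , shifted) → shadowed n now , stepped n next shifted })
    (realized n ⊗ (let N , t = realized n in N , λ k N≤k → t (suc k) (ℕₚ.m≤n⇒m≤1+n N≤k)) ⊗ shift-trace n)

  -- The next stage realizes e over w n, so it also visits the point where w n and e coincide.
  switch : ∀ n → Frequently λ k → ∀ {i} → i ℕ.< n → trace (suc n) k i ≡ trace n k i
  switch n N =
    let p , m = S⁺.back S.common
        k , N≤k , _ , agree =
            visit (applyUpTo (w n) n ++ applyUpTo (w (suc n)) (suc n)) A.⊤ p (Point.⊤-hom (restrict ι p)) N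
    in k , N≤k , λ i<n →
      ≡.trans (agree (∈-++⁺ʳ (applyUpTo (w n) n) (∈-applyUpTo⁺ (w (suc n)) (ℕₚ.m≤n⇒m≤1+n i<n))))
      (≡.trans (Match.now m (ℕₚ.m≤n⇒m≤1+n i<n))
      (≡.trans (≡.sym (S.coincide i<n))
      (≡.trans (≡.sym (Match.agree m (∈-++⁺ʳ (applyUpTo a (suc n)) (∈-applyUpTo⁺ (w n) i<n))))
      (≡.sym (agree (∈-++⁺ˡ (∈-applyUpTo⁺ (w n) i<n)))))))
    where
    module S = Aligned (stage n)
    module S⁺ = Aligned (stage (suc n))

  -- A point of a nonzero `e i` is matched at stage `n` by a point of `w n i`, whose trace is
  -- therefore infinite; one bound `M` serves all `i < n`.
  visited : ∀ n N → Eventually λ M → ∀ i → i ℕ.< n → Not (e i B.≈ B.⊥) → ∃[ k ] N ℕ.≤ k × k ℕ.< M × trace n k i ≡ true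
  visited n N = eventually-map (λ M f i i<n → f i i<n i<n) (eventually-∀< visited₁ n)
    where
    open Classical em
    open Ultrafilter 𝔹 countable𝔹
    visited₁ : ∀ i → Eventually λ M → i ℕ.< n → Not (e i B.≈ B.⊥) → ∃[ k ] N ℕ.≤ k × k ℕ.< M × trace n k i ≡ true
    visited₁ i with em {i ℕ.< n × Not (e i B.≈ B.⊥)}
    ... | no ¬both = 0 , λ _ _ i<n eᵢ≉⊥ → contradiction (i<n , eᵢ≉⊥) ¬both
    ... | yes (i<n , eᵢ≉⊥) =
      let q , q∈eᵢ = pointIn (e i) eᵢ≉⊥
          p , m = Aligned.back (stage n) q
          k , N≤k , traced , _ = visit [] (w n i) p (≡.trans (Match.now m i<n) q∈eᵢ) N
      in suc k , λ M k<M _ _ → k , N≤k , k<M , traced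

  -- `time` ends stage `n`, begun at `s`, and starts stage `n + 1`: the visits fall before it, the
  -- settled times from it on.
  record Next (n s : ℕ) : Set where
    field
      time     : ℕ
      later    : s ℕ.< time
      settled  : ∀ k → time ℕ.≤ k → (∃[ p ] Shadows (suc n) k p) × Steps (suc n) k
      switches : ∀ {i} → i ℕ.< n → trace (suc n) time i ≡ trace n time i
      visits   : ∀ i → i ℕ.< n → Not (e i B.≈ B.⊥) → ∃[ k ] s ℕ.≤ k × k ℕ.< time × trace n k i ≡ true

  abstract
    next : ∀ n s → Next n s
    next n s =
      let N , both = good (suc n) ⊗ visited n s
          t , sN≤t , sw = switch n (suc s ℕ.⊔ N)
          N≤t = ℕₚ.m⊔n≤o⇒n≤o (suc s) N sN≤t
      in record
        { time = t
        ; later = ℕₚ.m⊔n≤o⇒m≤o (suc s) N sN≤t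
        ; settled = λ k t≤k → proj₁ (both k (ℕₚ.≤-trans N≤t t≤k))
        ; switches = sw
        ; visits = proj₂ (both t N≤t)
        }

  -- The schedule of the stages and the sequence of points.

  s : ℕ → ℕ
  s zero    = 0
  s (suc n) = Next.time (next n (s n))

  s-mono : ∀ {m n} → m ℕ.≤′ n → s m ℕ.≤ s n
  s-mono (ℕ.≤′-reflexive ≡.refl) = ℕₚ.≤-refl
  s-mono (ℕ.≤′-step {n} m≤n) = ℕₚ.≤-trans (s-mono m≤n) (ℕₚ.<⇒≤ (Next.later (next n (s n))))

  n≤s : ∀ n → n ℕ.≤ s n
  n≤s zero    = ℕ.z≤n
  n≤s (suc n) = ℕₚ.≤-<-trans (n≤s n) (Next.later (next n (s n)))

  Active : ℕ → ℕ → Set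
  Active n k = s n ℕ.≤ k × k ℕ.< s (suc n)

  locate : ∀ k → ∃[ n ] Active n k
  locate zero = 0 , ℕ.z≤n , Next.later (next 0 0)
  locate (suc k) with locate k
  ... | n , sn≤k , k<sn⁺ with s (suc n) ℕ.≤? suc k
  ...   | yes le = suc n , le , ℕₚ.≤-<-trans k<sn⁺ (Next.later (next (suc n) (s (suc n))))
  ...   | no ¬le = n , ℕₚ.m≤n⇒m≤1+n sn≤k , ℕₚ.≰⇒> ¬le

  active-≤ : ∀ {m n k} → s m ℕ.≤ k → Active n k → m ℕ.≤ n
  active-≤ {m} {n} sm≤k (_ , k<sn⁺) with m ℕ.≤? n
  ... | yes m≤n = m≤n
  ... | no ¬m≤n = contradiction (s-mono (ℕₚ.≤⇒≤′ (ℕₚ.≰⇒> ¬m≤n))) (ℕₚ.<⇒≱ (ℕₚ.≤-<-trans sm≤k k<sn⁺))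

  active-unique : ∀ {m n k} → Active m k → Active n k → m ≡ n
  active-unique act act' = ℕₚ.≤-antisym (active-≤ (proj₁ act) act') (active-≤ (proj₁ act') act)

  shadow : ∀ n k → Active n k → ∃[ p ] Shadows n k p
  -- Stage `0` prescribes nothing, so it can start at time `0` with an arbitrary point.
  shadow zero    k act = p₀ , record { extends = λ () ; follows = λ () }
  shadow (suc n) k act = proj₁ (Next.settled (next n (s n)) k (proj₁ act))

  P : ℕ → Point 𝔹
  P k = let n , act = locate k in proj₁ (shadow n k act)

  P-shadows : ∀ {n k} → Active n k → Shadows n k (P k)
  P-shadows {n} {k} act with locate k
  ... | m , act' with active-unique act' act
  ...   | ≡.refl = proj₂ (shadow n k act')

  -- At the time of a switch the traces of the two stages agree.
  P-next : ∀ {n k i} → Active n k → i ℕ.< n → at (P (suc k)) (e i) ≡ trace n (suc k) i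
  P-next {n} {k} {i} act i<n with ℕₚ.m≤n⇒m<n∨m≡n (proj₂ act)
  ... | inj₁ lt = Shadows.follows (P-shadows (ℕₚ.m≤n⇒m≤1+n (proj₁ act) , lt)) i<n
  ... | inj₂ eq = ≡.trans
    (Shadows.follows (P-shadows
        (ℕₚ.≤-reflexive (≡.sym eq) , subst (ℕ._< s (suc (suc n))) (≡.sym eq)
            (Next.later (next (suc n) (s (suc n)))))) (ℕₚ.m≤n⇒m≤1+n i<n))
    (subst (λ t → trace (suc n) t i ≡ trace n t i) (≡.sym eq) (Next.switches (next n (s n)) i<n))

  -- Both prescriptions are realized by `Z.point` and its predecessor, and the predecessor contains
  -- `e i` exactly when `Z.point` contains `B.aut (e i)`.
  P-aut : ∀ {n k i j} → Active (suc n) k → i ℕ.< suc n → j ℕ.< suc n → B.aut (e i) B.≈ e j →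
          at (P (suc k)) (e j) ≡ at (P k) (e i)
  P-aut {n} {k} {i} {j} act i<n j<n βeᵢ≈eⱼ = begin
    at (P (suc k)) (e j)      ≡⟨ P-next act j<n ⟩
    trace (suc n) (suc k) j   ≡⟨ Z.target j<n ⟨
    at Z.point (e j)          ≡⟨ Point.≈-cong Z.point βeᵢ≈eⱼ ⟨
    at (T Z.point) (e i)      ≡⟨ Z.source i<n ⟩
    trace (suc n) k i         ≡⟨ Shadows.follows (P-shadows act) i<n ⟨
    at (P k) (e i)            ∎
    where
    open ≡.≡-Reasoning
    module Z = Steps (proj₂ (Next.settled (next n (s n)) k (proj₁ act)))

  -- The embedding read off the sequence of points.

  map : B.Carrier → Subset
  map x k = at (P k) x

  map-extends : ∀ x → map (ι.map x) =* η.map x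
  map-extends x =
    let m , aₘ≈x = proj₂ countable𝔸 x
        M , ηaₘ≡ηx = IsBoolHom.≈-cong η.hom aₘ≈x
    in eventually-map
         (λ { k (eq , eq') → ≡.trans (Point.≈-cong (restrict ι (P k)) (A.sym aₘ≈x)) (≡.trans eq eq') })
         ((s (suc m) , early m) ⊗ (M , ηaₘ≡ηx))
    where
    early : ∀ m k → s (suc m) ℕ.≤ k → ev (P k) (a m) ≡ η.map (a m) k
    early m k sm⁺≤k with locate k
    -- From time `s (suc m)` on the active stage is at least `suc m`; so it is not `0`, and its list
    -- contains `a m`.
    ... | zero  , act = contradiction (active-≤ sm⁺≤k act) λ ()
    ... | suc n , act = Shadows.extends (proj₂ (shadow (suc n) k act)) (∈-++⁺ˡ (∈-applyUpTo⁺ a (active-≤ sm⁺≤k act)))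

  map-commutes : ∀ x → map (B.aut x) =* shift (map x)
  -- The time one earlier must also lie in a stage beyond `i` and `j`, hence the outer `suc`.
  map-commutes x = suc (s (suc (i ℕ.⊔ j))) , commutes
    where
    i = proj₁ (proj₂ countable𝔹 x)
    eᵢ≈x = proj₂ (proj₂ countable𝔹 x)
    j = proj₁ (proj₂ countable𝔹 (B.aut x))
    eⱼ≈βx = proj₂ (proj₂ countable𝔹 (B.aut x))
    at-active : ∀ {n k} → i ℕ.⊔ j ℕ.< n → Active n k → map (B.aut x) (suc k) ≡ map x k
    at-active {suc n} {k} i⊔j<n act =
      ≡.trans (Point.≈-cong (P (suc k)) (B.sym eⱼ≈βx))
      (≡.trans (P-aut act (ℕₚ.≤-<-trans (ℕₚ.m≤m⊔n i j) i⊔j<n) (ℕₚ.≤-<-trans (ℕₚ.m≤n⊔m i j) i⊔j<n)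
                 (B.trans (B.aut-cong eᵢ≈x) (B.sym eⱼ≈βx)))
      (Point.≈-cong (P k) eᵢ≈x))
    commutes : ∀ k → suc (s (suc (i ℕ.⊔ j))) ℕ.≤ k → map (B.aut x) k ≡ shift (map x) k
    commutes (suc k) (ℕ.s≤s le) = let n , act = locate k in at-active (active-≤ le act) act

  map-frequently : ∀ {x} → Not (x B.≈ B.⊥) → Frequently λ k → map x k ≡ true
  map-frequently {x} x≉⊥ N =
    let i , eᵢ≈x = proj₂ countable𝔹 x
        -- Stage `n` prescribes `e i` because `i < n`, and it starts no earlier than `N` because `n`
        -- is at most `s n`.
        n = suc (i ℕ.⊔ N)
        k , sn≤k , k<sn⁺ , traced = Next.visits (next n (s n)) i (ℕ.s≤s (ℕₚ.m≤m⊔n i N))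
                                      (λ eᵢ≈⊥ → x≉⊥ (B.trans (B.sym eᵢ≈x) eᵢ≈⊥))
    in k , ℕₚ.≤-trans (ℕₚ.m≤n⊔m i N) (ℕₚ.≤-trans (ℕₚ.n≤1+n _) (ℕₚ.≤-trans (n≤s n) sn≤k))
         , ≡.trans (Point.≈-cong (P k) (B.sym eᵢ≈x))
                   (≡.trans (Shadows.follows (P-shadows (sn≤k , k<sn⁺)) (ℕ.s≤s (ℕₚ.m≤m⊔n i N))) traced)

  -- Otherwise `x ∧ ¬ y` is nonzero and contains `P k` for some late `k`, although both images agree
  -- there.
  map-reflects-≤ : ∀ {x y} → map x =* map y → x B.≤ y
  map-reflects-≤ {x} {y} (N , eq) = B.x∧¬y≈⊥⇒x≤y (em⇒dne em λ x∧¬y≉⊥ →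
    let k , N≤k , true-at-k = map-frequently x∧¬y≉⊥ N
        xk , ¬yk = ∧-true (≡.trans (≡.sym (Point.∧-hom (P k) x (B.¬ y))) true-at-k)
    in true≢false (≡.trans (≡.sym (eq k N≤k)) xk) (Boolₚ.not-injective (≡.trans (≡.sym (Point.¬-hom (P k) y)) ¬yk)))

  embedding : Embedding 𝔹 PωFinσ
  embedding = record
    { map = map
    ; hom = record
      { ≈-cong = λ x≈y → 0 , λ k _ → Point.≈-cong (P k) x≈y
      ; ∨-hom = λ x y → 0 , λ k _ → Point.∨-hom (P k) x y
      ; ∧-hom = λ x y → 0 , λ k _ → Point.∧-hom (P k) x y
      ; ¬-hom = λ x → 0 , λ k _ → Point.¬-hom (P k) x
      ; ⊤-hom = 0 , λ k _ → Point.⊤-hom (P k)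
      ; ⊥-hom = 0 , λ k _ → Point.⊥-hom (P k)
      }
    ; inj = λ eq → B.antisym (map-reflects-≤ eq) (map-reflects-≤ (P.sym eq))
    ; commute = map-commutes
    }

theorem9p6 : (𝔸 𝔹 : DynSys) → Countable 𝔸 → Countable 𝔹 →
    Incompressible 𝔸 → Incompressible 𝔹 →
    (ι : Embedding 𝔸 𝔹) → (η : Embedding 𝔸 PωFinσ) →
    Polarized 𝔸 →
    Σ (Embedding 𝔹 PωFinσ) λ η̄ →
    ∀ x → Embedding.map η̄ (Embedding.map ι x) =* Embedding.map η x
theorem9p6 𝔸 𝔹 countable𝔸 countable𝔹 inc𝔸 inc𝔹 ι η polarized =
  E.embedding , E.map-extends
  where
  module A = Order 𝔸
  module B = Order 𝔹
  module P = DynSys PωFinσ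
  -- `P(ω)/Fin` is nontrivial, and `η` preserves `⊤` and `⊥`.
  ⊤≉⊥ : Not (A.⊤ A.≈ A.⊥)
  ⊤≉⊥ eq =
    let N , true≡false = P.trans (P.sym (IsBoolHom.⊤-hom (Embedding.hom η)))
                           (P.trans (IsBoolHom.≈-cong (Embedding.hom η) eq) (IsBoolHom.⊥-hom (Embedding.hom η)))
    in true≢false ≡.refl (true≡false N ℕₚ.≤-refl)
  em : ExcludedMiddle 0ℓ
  em = polarized⇒em 𝔸 ⊤≉⊥ inc𝔸 polarized
  p₀ : Point 𝔹
  p₀ = proj₁ (Classical.Ultrafilter.pointIn em 𝔹 countable𝔹 B.⊤ λ eq → ⊤≉⊥ (Embedding.inj ι
    (B.trans (IsBoolHom.⊤-hom (Embedding.hom ι)) (B.trans eq (B.sym (IsBoolHom.⊥-hom (Embedding.hom ι)))))))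
  module E = Extension em countable𝔸 countable𝔹 inc𝔹 ι η polarized p₀
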